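{- There is a Turing ideal $\mathcal{I} \subseteq \mathcal{P}(\omega)$ such that the $\omega$-model $(\omega, \mathcal{I})$ satisfies $\mathsf{ADS}$ but not $\mathsf{SCAC}$. Therefore, $\mathsf{ADS}$ does not imply $\mathsf{SCAC}$ (over $\mathsf{RCA}_0$).
   Context: A Turing ideal is a nonempty collection of subsets of $\omega$ closed under Turing reducibility and join; $(\omega,\mathcal{I})$ is the $\omega$-model of second order arithmetic with second order part $\mathcal{I}$ (a model of $\mathsf{RCA}_0$). Infinite structures have domain $\mathbb{N}$. $\mathsf{ADS}$: for every infinite linear order $L=(\mathbb{N},<_L)$ there is a function $f:\mathbb{N}\to\mathbb{N}$ which is either an infinite ascending sequence in $L$ (for all $n<m$, $f(n)<_L f(m)$) or an infinite descending sequence in $L$ (for all $n<m$, $f(n)>_L f(m)$). For an infinite poset $M=(\mathbb{N},\preceq_M)$, write $x\,|_M\,y$ if $x,y$ are incomparable, i.e. $x\not\preceq_M y$ and $y\not\preceq_M x$. A set $S$ is a chain if any two of its elements are comparable, and an antichain if any two distinct elements are incomparable. Let $A^*(M)=\{n\mid \exists x\,\forall y>x\,(n\preceq_M y)\}$, $B^*(M)=\{n\mid \exists x\,\forall y>x\,(n\,|_M\,y)\}$, $C^*(M)=\{n\mid \exists x\,\forall y>x\,(y\preceq_M n)\}$ (here $>$ is the usual order on $\mathbb{N}$). $M$ is stable if $A^*(M)\cup B^*(M)=\mathbb{N}$ or $C^*(M)\cup B^*(M)=\mathbb{N}$. $\mathsf{SCAC}$: every infinite stable poset $M$ contains either an infinite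 chain or an infinite antichain. -}

module Defs where

open import Data.Bool.Base using (Bool; T; if_then_else_)
open import Data.Empty using (⊥)
open import Data.Fin as Fin using (Fin; zero; suc; #_)
open import Data.List.Base as List using (List; []; _∷_)
open import Data.List.Membership.Propositional using (_∈_)
open import Data.List.Relation.Unary.All using (All)
open import Data.Nat.Base
  using (ℕ; zero; suc; _+_; _*_; _<_; _>_; _/_; _%_; _≡ᵇ_)
open import Data.Nat.Properties using (_<?_)
open import Data.Product using (∃; ∃-syntax; _×_; _,_)
open import Data.Sum using (_⊎_)
open import Data.Vec.Base as Vec using (Vec; []; _∷_)
open import Data.Vec.Functional as Env using (Vector)
open import Data.Vec.Relation.Binary.Pointwise.Inductive using (Pointwise)
open import Function.Base using (id; _∘_)
open import Level using (0ℓ)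
open import Relation.Binary.PropositionalEquality using (_≡_; _≢_; refl)
open import Relation.Nullary using (¬_)
open import Relation.Nullary.Decidable using (True)
open import Relation.Unary using (Pred)

------------------------------------------------------------------------
-- Turing reducibility and Turing ideals

-- Subsets of ω are given by characteristic functions.
Subset : Set
Subset = ℕ → Bool

χ : Subset → ℕ → ℕ
χ X n = if X n then 1 else 0

-- Codes for the partial functions that are μ-recursive in an oracle.
data Code : ℕ → Set where
  zeroᶜ  : Code 0
  sucᶜ   : Code 1
  oracle : Code 1
  proj   : ∀ {k} → Fin k → Code k
  comp   : ∀ {j k} → Code j → Vec (Code k) j → Code k
  prec   : ∀ {k} → Code k → Code (suc (suc k)) → Code (suc k)
  min    : ∀ {k} → Code (suc k) → Code k

-- f [ X ] xs ⇓ y : the function coded by f, with oracle X, converges on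
-- input xs with output y.
infix 4 _[_]_⇓_

data _[_]_⇓_ : ∀ {k} → Code k → Subset → Vec ℕ k → ℕ → Set where
  zero⇓   : ∀ {X} → zeroᶜ [ X ] [] ⇓ 0
  suc⇓    : ∀ {X n} → sucᶜ [ X ] (n ∷ []) ⇓ suc n
  oracle⇓ : ∀ {X n} → oracle [ X ] (n ∷ []) ⇓ χ X n
  proj⇓   : ∀ {X k} {i : Fin k} {xs} → proj i [ X ] xs ⇓ Vec.lookup xs i
  comp⇓   : ∀ {X j k} {f : Code j} {gs : Vec (Code k) j} {xs ys z} →
            Pointwise (λ g y → g [ X ] xs ⇓ y) gs ys →
            f [ X ] ys ⇓ z →
            comp f gs [ X ] xs ⇓ z
  prec⇓₀  : ∀ {X k} {f : Code k} {g xs y} →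
            f [ X ] xs ⇓ y →
            prec f g [ X ] (0 ∷ xs) ⇓ y
  prec⇓₊  : ∀ {X k} {f : Code k} {g xs n y z} →
            prec f g [ X ] (n ∷ xs) ⇓ y →
            g [ X ] (n ∷ y ∷ xs) ⇓ z →
            prec f g [ X ] (suc n ∷ xs) ⇓ z
  min⇓    : ∀ {X k} {f : Code (suc k)} {xs n} →
            f [ X ] (n ∷ xs) ⇓ 0 →
            (∀ i → i < n → ∃[ y ] (f [ X ] (i ∷ xs) ⇓ suc y)) →
            min f [ X ] xs ⇓ n

infix 4 _≤ᵀ_

_≤ᵀ_ : Subset → Subset → Set
X ≤ᵀ Y = ∃[ e ] (∀ n → e [ Y ] (n ∷ []) ⇓ χ X n)

-- X ⊕ Y = {2n | n ∈ X} ∪ {2n+1 | n ∈ Y}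
infixr 6 _⊕_

_⊕_ : Subset → Subset → Subset
(X ⊕ Y) n = if n % 2 ≡ᵇ 0 then X (n / 2) else Y (n / 2)

record TuringIdeal (I : Pred Subset 0ℓ) : Set where
  field
    nonempty  : ∃[ X ] I X
    downward  : ∀ {X Y} → X ≤ᵀ Y → I Y → I X
    join      : ∀ {X Y} → I X → I Y → I (X ⊕ Y)

------------------------------------------------------------------------
-- The language of second order arithmetic

-- De Bruijn syntax: in Form m n there are m set variables and n number
-- variables in scope, and index 0 is the innermost binder of its sort.

infixl 8 _`*_
infixl 7 _`+_
infix  6 _`≡_ _`<_ _`∈_
infixr 5 _`∧_
infixr 4 _`∨_
infixr 3 _`⇒_
infix  3 _`⇔_
infixr 2 ∀ⁿ_ ∃ⁿ_ ∀ˢ_ ∃ˢ_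

data Term (n : ℕ) : Set where
  var       : Fin n → Term n
  `0 `1     : Term n
  _`+_ _`*_ : Term n → Term n → Term n

data Form (m n : ℕ) : Set where
  _`≡_ _`<_      : Term n → Term n → Form m n
  _`∈_           : Term n → Fin m → Form m n
  `⊥             : Form m n
  _`∧_ _`∨_ _`⇒_ : Form m n → Form m n → Form m n
  ∀ⁿ_ ∃ⁿ_        : Form m (suc n) → Form m n
  ∀ˢ_ ∃ˢ_        : Form (suc m) n → Form m n

Sentence : Set
Sentence = Form 0 0

`¬_ : ∀ {m n} → Form m n → Form m n
`¬ φ = φ `⇒ `⊥

_`⇔_ : ∀ {m n} → Form m n → Form m n → Form m n
φ `⇔ ψ = (φ `⇒ ψ) `∧ (ψ `⇒ φ)

v : ∀ i {n} {i<n : True (i <? n)} → Term n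
v i {i<n = i<n} = var (#_ i {m<n = i<n})

subᵗ : ∀ {n n′} → (Fin n → Term n′) → Term n → Term n′
subᵗ τ (var i)  = τ i
subᵗ τ `0       = `0
subᵗ τ `1       = `1
subᵗ τ (s `+ t) = subᵗ τ s `+ subᵗ τ t
subᵗ τ (s `* t) = subᵗ τ s `* subᵗ τ t

wkᵗ : ∀ {n} → Term n → Term (suc n)
wkᵗ = subᵗ (var ∘ suc)

liftⁿ : ∀ {n n′} → (Fin n → Term n′) → Fin (suc n) → Term (suc n′)
liftⁿ τ zero    = var zero
liftⁿ τ (suc i) = wkᵗ (τ i)

-- Simultaneous capture-avoiding substitution of set variables for set
-- variables and of terms for number variables.
sub : ∀ {m m′ n n′} → (Fin m → Fin m′) → (Fin n → Term n′) →
      Form m n → Form m′ n′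
sub ρ τ (s `≡ t) = subᵗ τ s `≡ subᵗ τ t
sub ρ τ (s `< t) = subᵗ τ s `< subᵗ τ t
sub ρ τ (t `∈ X) = subᵗ τ t `∈ ρ X
sub ρ τ `⊥       = `⊥
sub ρ τ (φ `∧ ψ) = sub ρ τ φ `∧ sub ρ τ ψ
sub ρ τ (φ `∨ ψ) = sub ρ τ φ `∨ sub ρ τ ψ
sub ρ τ (φ `⇒ ψ) = sub ρ τ φ `⇒ sub ρ τ ψ
sub ρ τ (∀ⁿ φ)   = ∀ⁿ sub ρ (liftⁿ τ) φ
sub ρ τ (∃ⁿ φ)   = ∃ⁿ sub ρ (liftⁿ τ) φ
sub ρ τ (∀ˢ φ)   = ∀ˢ sub (Fin.lift 1 ρ) τ φ
sub ρ τ (∃ˢ φ)   = ∃ˢ sub (Fin.lift 1 ρ) τ φ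

wkⁿ : ∀ {m n} → Form m n → Form m (suc n)
wkⁿ = sub id (var ∘ suc)

wkˢ : ∀ {m n} → Form m n → Form (suc m) n
wkˢ = sub suc var

_[_]ⁿ : ∀ {m n} → Form m (suc n) → Term n → Form m n
φ [ t ]ⁿ = sub id (t Env.∷ var) φ

_[_]ˢ : ∀ {m n} → Form (suc m) n → Fin m → Form m n
φ [ X ]ˢ = sub (X Env.∷ id) var φ

------------------------------------------------------------------------
-- Satisfaction in the ω-model (ω, I)

⟦_⟧ : ∀ {n} → Term n → Vector ℕ n → ℕ
⟦ var i ⟧  ν = ν i
⟦ `0 ⟧     ν = 0
⟦ `1 ⟧     ν = 1
⟦ s `+ t ⟧ ν = ⟦ s ⟧ ν + ⟦ t ⟧ ν
⟦ s `* t ⟧ ν = ⟦ s ⟧ ν * ⟦ t ⟧ ν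

Sat : Pred Subset 0ℓ → ∀ {m n} → Vector Subset m → Vector ℕ n →
      Form m n → Set
Sat I σ ν (s `≡ t) = ⟦ s ⟧ ν ≡ ⟦ t ⟧ ν
Sat I σ ν (s `< t) = ⟦ s ⟧ ν < ⟦ t ⟧ ν
Sat I σ ν (t `∈ X) = T (σ X (⟦ t ⟧ ν))
Sat I σ ν `⊥       = ⊥
Sat I σ ν (φ `∧ ψ) = Sat I σ ν φ × Sat I σ ν ψ
Sat I σ ν (φ `∨ ψ) = Sat I σ ν φ ⊎ Sat I σ ν ψ
Sat I σ ν (φ `⇒ ψ) = Sat I σ ν φ → Sat I σ ν ψ
Sat I σ ν (∀ⁿ φ)   = ∀ a → Sat I σ (a Env.∷ ν) φ
Sat I σ ν (∃ⁿ φ)   = ∃[ a ] Sat I σ (a Env.∷ ν) φ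
Sat I σ ν (∀ˢ φ)   = ∀ X → I X → Sat I (X Env.∷ σ) ν φ
Sat I σ ν (∃ˢ φ)   = ∃[ X ] (I X × Sat I (X Env.∷ σ) ν φ)

infix 1 _⊨_

_⊨_ : Pred Subset 0ℓ → Sentence → Set
I ⊨ φ = Sat I Env.[] Env.[] φ

------------------------------------------------------------------------
-- Derivability: classical two-sorted natural deduction with equality

infix 1 _⊢_

data _⊢_ {m n : ℕ} (Γ : List (Form m n)) : Form m n → Set where
  hyp  : ∀ {φ} → φ ∈ Γ → Γ ⊢ φ
  raa  : ∀ {φ} → (`¬ φ) ∷ Γ ⊢ `⊥ → Γ ⊢ φ
  ∧I   : ∀ {φ ψ} → Γ ⊢ φ → Γ ⊢ ψ → Γ ⊢ φ `∧ ψ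
  ∧E₁  : ∀ {φ ψ} → Γ ⊢ φ `∧ ψ → Γ ⊢ φ
  ∧E₂  : ∀ {φ ψ} → Γ ⊢ φ `∧ ψ → Γ ⊢ ψ
  ∨I₁  : ∀ {φ ψ} → Γ ⊢ φ → Γ ⊢ φ `∨ ψ
  ∨I₂  : ∀ {φ ψ} → Γ ⊢ ψ → Γ ⊢ φ `∨ ψ
  ∨E   : ∀ {φ ψ θ} → Γ ⊢ φ `∨ ψ → φ ∷ Γ ⊢ θ → ψ ∷ Γ ⊢ θ → Γ ⊢ θ
  ⇒I   : ∀ {φ ψ} → φ ∷ Γ ⊢ ψ → Γ ⊢ φ `⇒ ψ
  ⇒E   : ∀ {φ ψ} → Γ ⊢ φ `⇒ ψ → Γ ⊢ φ → Γ ⊢ ψ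
  ∀ⁿI  : ∀ {φ} → List.map wkⁿ Γ ⊢ φ → Γ ⊢ ∀ⁿ φ
  ∀ⁿE  : ∀ {φ} t → Γ ⊢ ∀ⁿ φ → Γ ⊢ φ [ t ]ⁿ
  ∃ⁿI  : ∀ {φ} t → Γ ⊢ φ [ t ]ⁿ → Γ ⊢ ∃ⁿ φ
  ∃ⁿE  : ∀ {φ ψ} → Γ ⊢ ∃ⁿ φ → φ ∷ List.map wkⁿ Γ ⊢ wkⁿ ψ → Γ ⊢ ψ
  ∀ˢI  : ∀ {φ} → List.map wkˢ Γ ⊢ φ → Γ ⊢ ∀ˢ φ
  ∀ˢE  : ∀ {φ} X → Γ ⊢ ∀ˢ φ → Γ ⊢ φ [ X ]ˢ
  ∃ˢI  : ∀ {φ} X → Γ ⊢ φ [ X ]ˢ → Γ ⊢ ∃ˢ φ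
  ∃ˢE  : ∀ {φ ψ} → Γ ⊢ ∃ˢ φ → φ ∷ List.map wkˢ Γ ⊢ wkˢ ψ → Γ ⊢ ψ
  ≡I   : ∀ {t} → Γ ⊢ t `≡ t
  ≡E   : ∀ φ {s t} → Γ ⊢ s `≡ t → Γ ⊢ φ [ s ]ⁿ → Γ ⊢ φ [ t ]ⁿ

infix 1 _⊩_

_⊩_ : Pred Sentence 0ℓ → Sentence → Set
Th ⊩ φ = ∃[ Γ ] (All Th Γ × (Γ ⊢ φ))

------------------------------------------------------------------------
-- RCA₀

data Σ⁰₀ {m n : ℕ} : Form m n → Set where
  eq   : ∀ {s t} → Σ⁰₀ (s `≡ t)
  lt   : ∀ {s t} → Σ⁰₀ (s `< t)
  mem  : ∀ {t X} → Σ⁰₀ (t `∈ X)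
  bot  : Σ⁰₀ `⊥
  and  : ∀ {φ ψ} → Σ⁰₀ φ → Σ⁰₀ ψ → Σ⁰₀ (φ `∧ ψ)
  or   : ∀ {φ ψ} → Σ⁰₀ φ → Σ⁰₀ ψ → Σ⁰₀ (φ `∨ ψ)
  imp  : ∀ {φ ψ} → Σ⁰₀ φ → Σ⁰₀ ψ → Σ⁰₀ (φ `⇒ ψ)
  ball : ∀ t {φ} → Σ⁰₀ φ → Σ⁰₀ (∀ⁿ v 0 `< wkᵗ t `⇒ φ)
  bex  : ∀ t {φ} → Σ⁰₀ φ → Σ⁰₀ (∃ⁿ v 0 `< wkᵗ t `∧ φ)

data Σ⁰₁ {m n : ℕ} : Form m n → Set where
  ex : ∀ {θ} → Σ⁰₀ θ → Σ⁰₁ (∃ⁿ θ)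

data Π⁰₁ {m n : ℕ} : Form m n → Set where
  all : ∀ {θ} → Σ⁰₀ θ → Π⁰₁ (∀ⁿ θ)

closeˢ : ∀ {m} → Form m 0 → Sentence
closeˢ {zero}  φ = φ
closeˢ {suc m} φ = closeˢ (∀ˢ φ)

-- Universal closure.
close : ∀ {m n} → Form m n → Sentence
close {n = zero}  φ = closeˢ φ
close {n = suc n} φ = close (∀ⁿ φ)

data RCA₀ : Pred Sentence 0ℓ where
  suc≢0   : RCA₀ (∀ⁿ `¬ (v 0 `+ `1 `≡ `0))
  suc-inj : RCA₀ (∀ⁿ ∀ⁿ v 1 `+ `1 `≡ v 0 `+ `1 `⇒ v 1 `≡ v 0)
  +-zero  : RCA₀ (∀ⁿ v 0 `+ `0 `≡ v 0)
  +-suc   : RCA₀ (∀ⁿ ∀ⁿ v 1 `+ (v 0 `+ `1) `≡ (v 1 `+ v 0) `+ `1)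
  *-zero  : RCA₀ (∀ⁿ v 0 `* `0 `≡ `0)
  *-suc   : RCA₀ (∀ⁿ ∀ⁿ v 1 `* (v 0 `+ `1) `≡ v 1 `* v 0 `+ v 1)
  ≮0      : RCA₀ (∀ⁿ `¬ (v 0 `< `0))
  <-suc   : RCA₀ (∀ⁿ ∀ⁿ v 1 `< v 0 `+ `1 `⇔ v 1 `< v 0 `∨ v 1 `≡ v 0)
  -- The substitution in the induction step sends v 0 to v 0 + 1 and fixes
  -- every other variable.
  Σ⁰₁-ind : ∀ {m n} {φ : Form m (suc n)} → Σ⁰₁ φ →
            RCA₀ (close (φ [ `0 ]ⁿ
                         `∧ (∀ⁿ φ `⇒ sub id ((v 0 `+ `1) Env.∷ (var ∘ suc)) φ)
                         `⇒ (∀ⁿ φ)))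
  Δ⁰₁-CA  : ∀ {m n} {φ ψ : Form m (suc n)} → Σ⁰₁ φ → Π⁰₁ ψ →
            RCA₀ (close ((∀ⁿ φ `⇔ ψ)
                         `⇒ (∃ˢ ∀ⁿ v 0 `∈ zero `⇔ wkˢ φ)))

------------------------------------------------------------------------
-- ADS and SCAC

-- The usual pairing polynomial of second order arithmetic,
-- (i , j) = (i + j)² + i; binary relations are sets of coded pairs.
infix 6 ⟨_,_⟩∈_

⟨_,_⟩∈_ : ∀ {m n} → Term n → Term n → Fin m → Form m n
⟨ s , t ⟩∈ X = (s `+ t) `* (s `+ t) `+ s `∈ X

module _ {m n : ℕ} where

  -- A linear order is given by its strict relation.
  IsLinearOrder : Fin m → Form m n
  IsLinearOrder L =
       (∀ⁿ `¬ (⟨ v 0 , v 0 ⟩∈ L))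
    `∧ (∀ⁿ ∀ⁿ ∀ⁿ ⟨ v 2 , v 1 ⟩∈ L `⇒ ⟨ v 1 , v 0 ⟩∈ L `⇒ ⟨ v 2 , v 0 ⟩∈ L)
    `∧ (∀ⁿ ∀ⁿ ⟨ v 1 , v 0 ⟩∈ L `∨ v 1 `≡ v 0 `∨ ⟨ v 0 , v 1 ⟩∈ L)

  -- A function ℕ → ℕ is given by its graph.
  IsFunction : Fin m → Form m n
  IsFunction F =
       (∀ⁿ ∃ⁿ ⟨ v 1 , v 0 ⟩∈ F)
    `∧ (∀ⁿ ∀ⁿ ∀ⁿ ⟨ v 2 , v 1 ⟩∈ F `⇒ ⟨ v 2 , v 0 ⟩∈ F `⇒ v 1 `≡ v 0)

  -- In the next two formulas F sends v 3 to v 1 and v 2 to v 0.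
  IsAscending : Fin m → Fin m → Form m n
  IsAscending L F =
    ∀ⁿ ∀ⁿ ∀ⁿ ∀ⁿ v 3 `< v 2 `⇒ ⟨ v 3 , v 1 ⟩∈ F `⇒ ⟨ v 2 , v 0 ⟩∈ F
                `⇒ ⟨ v 1 , v 0 ⟩∈ L

  IsDescending : Fin m → Fin m → Form m n
  IsDescending L F =
    ∀ⁿ ∀ⁿ ∀ⁿ ∀ⁿ v 3 `< v 2 `⇒ ⟨ v 3 , v 1 ⟩∈ F `⇒ ⟨ v 2 , v 0 ⟩∈ F
                `⇒ ⟨ v 0 , v 1 ⟩∈ L

  -- A partial order is given by its reflexive relation.
  IsPoset : Fin m → Form m n
  IsPoset M =
       (∀ⁿ ⟨ v 0 , v 0 ⟩∈ M)
    `∧ (∀ⁿ ∀ⁿ ⟨ v 1 , v 0 ⟩∈ M `⇒ ⟨ v 0 , v 1 ⟩∈ M `⇒ v 1 `≡ v 0)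
    `∧ (∀ⁿ ∀ⁿ ∀ⁿ ⟨ v 2 , v 1 ⟩∈ M `⇒ ⟨ v 1 , v 0 ⟩∈ M `⇒ ⟨ v 2 , v 0 ⟩∈ M)

  Comparable Incomparable : Fin m → Term n → Term n → Form m n
  Comparable   M s t = ⟨ s , t ⟩∈ M `∨ ⟨ t , s ⟩∈ M
  Incomparable M s t = `¬ (⟨ s , t ⟩∈ M) `∧ `¬ (⟨ t , s ⟩∈ M)

module _ {m n : ℕ} where

  -- Membership of v 0 in A*(M), B*(M), C*(M); under the two quantifiers
  -- that element is v 2.
  A* B* C* : Fin m → Form m (suc n)
  A* M = ∃ⁿ ∀ⁿ v 1 `< v 0 `⇒ ⟨ v 2 , v 0 ⟩∈ M
  B* M = ∃ⁿ ∀ⁿ v 1 `< v 0 `⇒ Incomparable M (v 2) (v 0)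
  C* M = ∃ⁿ ∀ⁿ v 1 `< v 0 `⇒ ⟨ v 0 , v 2 ⟩∈ M

  IsInfinite : Fin m → Form m n
  IsInfinite S = ∀ⁿ ∃ⁿ v 1 `< v 0 `∧ v 0 `∈ S

  IsChain IsAntichain : Fin m → Fin m → Form m n
  IsChain M S =
    ∀ⁿ ∀ⁿ v 1 `∈ S `⇒ v 0 `∈ S `⇒ Comparable M (v 1) (v 0)
  IsAntichain M S =
    ∀ⁿ ∀ⁿ v 1 `∈ S `⇒ v 0 `∈ S `⇒ `¬ (v 1 `≡ v 0)
          `⇒ Incomparable M (v 1) (v 0)

IsStable : ∀ {m n} → Fin m → Form m n
IsStable M = (∀ⁿ A* M `∨ B* M) `∨ (∀ⁿ C* M `∨ B* M)

ADS : Sentence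
ADS = ∀ˢ IsLinearOrder zero
         `⇒ (∃ˢ IsFunction zero
                `∧ (IsAscending (suc zero) zero
                    `∨ IsDescending (suc zero) zero))

SCAC : Sentence
SCAC = ∀ˢ IsPoset zero `∧ IsStable zero
          `⇒ (∃ˢ IsInfinite zero
                 `∧ (IsChain (suc zero) zero
                     `∨ IsAntichain (suc zero) zero))

------------------------------------------------------------------------
-- What ADS and SCAC say in (ω, I), with the de Bruijn indices resolved

Rel : Subset → ℕ → ℕ → Set
Rel X a b = T (X ((a + b) * (a + b) + a))

⊨ADS : ∀ I → (I ⊨ ADS) ≡
  (∀ L → I L → let _<ᴸ_ = Rel L in
     (∀ x → ¬ (x <ᴸ x))
   × (∀ x y z → x <ᴸ y → y <ᴸ z → x <ᴸ z)
   × (∀ x y → x <ᴸ y ⊎ x ≡ y ⊎ y <ᴸ x) →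
   ∃[ F ] (I F × let _↦_ = Rel F in
     ((∀ x → ∃[ y ] (x ↦ y))
      × (∀ x y z → x ↦ y → x ↦ z → y ≡ z))
     × ((∀ k l a b → k < l → k ↦ a → l ↦ b → a <ᴸ b)
        ⊎ (∀ k l a b → k < l → k ↦ a → l ↦ b → b <ᴸ a))))
⊨ADS I = refl

⊨SCAC : ∀ I → (I ⊨ SCAC) ≡
  (∀ M → I M →
   let _≼_ = Rel M
       _∣_ = λ x y → ¬ (x ≼ y) × ¬ (y ≼ x)
       A   = λ a → ∃[ x ] (∀ y → y > x → a ≼ y)
       B   = λ a → ∃[ x ] (∀ y → y > x → a ∣ y)
       C   = λ a → ∃[ x ] (∀ y → y > x → y ≼ a)
   in
     ((∀ x → x ≼ x)
      × (∀ x y → x ≼ y → y ≼ x → x ≡ y)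
      × (∀ x y z → x ≼ y → y ≼ z → x ≼ z))
   × ((∀ a → A a ⊎ B a) ⊎ (∀ a → C a ⊎ B a)) →
   ∃[ S ] (I S × let _∈S = λ x → T (S x) in
     (∀ x → ∃[ y ] (y > x × (y ∈S)))
     × ((∀ x y → x ∈S → y ∈S → x ≼ y ⊎ y ≼ x)
        ⊎ (∀ x y → x ∈S → y ∈S → x ≢ y → x ∣ y))))
⊨SCAC I = refl

{-# OPTIONS --safe #-}

-- A pair of sets A, B is (the complement of) a dependently hyperimmune pair
-- relative to Z when every Z-enumerable relation W such that
-- ∀x ∃R>x ∀y ∃S>y W(R,S) holds of some finite R ⊆ A and S ⊆ B (Patey).  A
-- generic stable poset M has this property relative to itself, with A = A*(M)
-- and B = B*(M), because any finite stage may be relabelled so that R gets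
-- label A and a later S gets label B.  It excludes infinite chains and
-- antichains: the former would be a subset of A, the latter a subset of B.
--
-- The property is preserved by adding a solution of any linear order L.  Build
-- an ascending σ and a descending τ with infinitely many elements between
-- them.  If requirements for σ and for τ are both essential, then so is their
-- conjunction over pairs of extensions σ′, τ′ with max σ′ < min τ′, so it can
-- be met; as every point lies above σ′ or below τ′, one of the two extensions
-- leaves an infinite interval.  Hence one side can satisfy all its
-- requirements.
--
-- Since excluded middle is available, "Z-enumerable" may be replaced by any
-- countable class of open relations that has the closure properties used.  The
-- types Decoder and Op are such a class, closed by construction, so nothing
-- has to be programmed in the μ-recursive calculus.
module Submission where

open import Defs
open import Axiom.ExcludedMiddle using (ExcludedMiddle)
open import Data.Bool.Base using (Bool; true; false; T; if_then_else_)
open import Data.Empty using (⊥; ⊥-elim)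
open import Data.Fin as Fin using (Fin; zero; suc; toℕ)
open import Data.List.Base as List using (List; []; _∷_; _++_; length)
open import Data.List.Membership.Propositional using (_∈_; find)
open import Data.List.Properties using (++-assoc; length-++)
open import Data.List.Relation.Binary.Pointwise as List≈ using ([]; _∷_)
open import Data.List.Relation.Unary.All as All using (All; []; _∷_)
import Data.List.Relation.Unary.All.Properties as All
open import Data.List.Relation.Unary.AllPairs as AllPairs using (AllPairs; []; _∷_)
open import Data.List.Relation.Unary.Any as Any using (Any; here)
open import Data.Nat.Base
open import Data.Nat.DivMod using (m*n/n≡m; m*n%n≡0; [m+kn]%n≡m%n; +-distrib-/-∣ʳ)
open import Data.Nat.Divisibility using (n∣m*n)
open import Data.Nat.Properties hiding (+-suc; *-suc)
import Data.Nat.Properties as ℕ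
open import Data.Product using (Σ; ∃-syntax; _×_; _,_; proj₁; proj₂; map₂)
open import Data.Sum as Sum using (_⊎_; inj₁; inj₂)
open import Data.Unit.Base using (⊤; tt)
open import Data.Vec.Base as Vec using (Vec; []; _∷_)
open import Data.Vec.Functional as Env using (Vector)
open import Data.Vec.Properties using (lookup∘tabulate; toList∘fromList)
open import Data.Vec.Relation.Binary.Pointwise.Inductive using (Pointwise; []; _∷_)
open import Function.Base using (_∘_; flip)
open import Level using (0ℓ)
open import Relation.Binary.Definitions using (tri<; tri≈; tri>)
open import Relation.Binary.PropositionalEquality
  using (_≡_; _≢_; refl; sym; trans; cong; cong₂; subst; subst₂; module ≡-Reasoning)
open import Relation.Nullary using (¬_; Dec; yes; no; does; contradiction)

-- Oracle computations

mutual
  ⇓-functional : ∀ {k X xs y z} {f : Code k} →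
                 f [ X ] xs ⇓ y → f [ X ] xs ⇓ z → y ≡ z
  ⇓-functional zero⇓ zero⇓ = refl
  ⇓-functional suc⇓ suc⇓ = refl
  ⇓-functional oracle⇓ oracle⇓ = refl
  ⇓-functional proj⇓ proj⇓ = refl
  ⇓-functional (comp⇓ ds d) (comp⇓ es e) with refl ← ⇓-functional* ds es =
    ⇓-functional d e
  ⇓-functional (prec⇓₀ d) (prec⇓₀ e) = ⇓-functional d e
  ⇓-functional (prec⇓₊ d d′) (prec⇓₊ e e′) with refl ← ⇓-functional d e =
    ⇓-functional d′ e′
  ⇓-functional (min⇓ {n = n} d ds) (min⇓ {n = m} e es) with <-cmp n m
  ... | tri≈ _ n≡m _ = n≡m
  ... | tri< n<m _ _ with () ← ⇓-functional d (proj₂ (es n n<m))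
  ... | tri> _ _ m<n with () ← ⇓-functional (proj₂ (ds m m<n)) e

  ⇓-functional* : ∀ {j k X xs} {gs : Vec (Code k) j} {ys zs} →
    Pointwise (λ g y → g [ X ] xs ⇓ y) gs ys →
    Pointwise (λ g y → g [ X ] xs ⇓ y) gs zs → ys ≡ zs
  ⇓-functional* [] [] = refl
  ⇓-functional* (d ∷ ds) (e ∷ es) =
    cong₂ _∷_ (⇓-functional d e) (⇓-functional* ds es)

infix 4 _≈[_]_
_≈[_]_ : ∀ {a} {A : Set a} → (ℕ → A) → ℕ → (ℕ → A) → Set a
f ≈[ k ] g = ∀ m → m < k → f m ≡ g m

≈-weaken : ∀ {a} {A : Set a} {f g : ℕ → A} {k k′} → k ≤ k′ →
           f ≈[ k′ ] g → f ≈[ k ] g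
≈-weaken k≤k′ f≈g m m<k = f≈g m (<-≤-trans m<k k≤k′)

-- Bounding: as `P i` is monotone in `k`, the maximum of finitely many bounds serves them all. It
-- serves μ-search, bounded quantifiers and initial segments of decoded sets alike.
boundedUse : ∀ {P : ℕ → ℕ → Set} →
             (∀ {i k k′} → k ≤ k′ → P i k → P i k′) →
             ∀ n → (∀ i → i < n → ∃[ k ] P i k) → ∃[ k ] (∀ i → i < n → P i k)
boundedUse mono zero h = 0 , λ i ()
boundedUse {P} mono (suc n) h
  with k , hk ← boundedUse {P} mono n (λ i i<n → h i (m<n⇒m<1+n i<n))
  with l , hl ← h n ≤-refl
  = k ⊔ l , λ i i≤n → case i i≤n
  where
  case : ∀ i → i < suc n → P i (k ⊔ l)
  case i i≤n with <-cmp i n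
  ... | tri< i<n _ _ = mono (m≤m⊔n k l) (hk i i<n)
  ... | tri≈ _ refl _ = mono (m≤n⊔m k l) hl
  ... | tri> _ _ n<i = ⊥-elim (<-irrefl refl (<-≤-trans n<i (s≤s⁻¹ i≤n)))

mutual
  -- The use principle: a derivation asks the oracle finitely many questions. For `min` these
  -- include the questions in all the searches below the root.
  ⇓-use : ∀ {k X xs y} {f : Code k} → f [ X ] xs ⇓ y →
          ∃[ u ] (∀ X′ → X ≈[ u ] X′ → f [ X′ ] xs ⇓ y)
  ⇓-use zero⇓ = 0 , λ _ _ → zero⇓
  ⇓-use suc⇓ = 0 , λ _ _ → suc⇓
  ⇓-use {X = X} (oracle⇓ {n = n}) = suc n , λ X′ X≈X′ →
    subst (λ b → oracle [ X′ ] (n ∷ []) ⇓ b)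
          (cong (λ b → χ (λ _ → b) n) (sym (X≈X′ n ≤-refl))) oracle⇓
  ⇓-use proj⇓ = 0 , λ _ _ → proj⇓
  ⇓-use (comp⇓ ds d) with u , h ← ⇓-use* ds | u′ , h′ ← ⇓-use d =
    u ⊔ u′ , λ X′ e → comp⇓ (h X′ (≈-weaken (m≤m⊔n u u′) e))
                             (h′ X′ (≈-weaken (m≤n⊔m u u′) e))
  ⇓-use (prec⇓₀ d) with u , h ← ⇓-use d = u , λ X′ e → prec⇓₀ (h X′ e)
  ⇓-use (prec⇓₊ d d′) with u , h ← ⇓-use d | u′ , h′ ← ⇓-use d′ =
    u ⊔ u′ , λ X′ e → prec⇓₊ (h X′ (≈-weaken (m≤m⊔n u u′) e))
                              (h′ X′ (≈-weaken (m≤n⊔m u u′) e))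
  ⇓-use {X = X} (min⇓ {f = f} {xs} {n} d ds)
    with u , h ← ⇓-use d
    with u′ , h′ ← boundedUse
           {λ i u → ∀ X′ → X ≈[ u ] X′ → ∃[ y ] f [ X′ ] (i ∷ xs) ⇓ suc y}
           (λ u≤v g X′ e → g X′ (≈-weaken u≤v e)) n (⇓-use-below ds) =
    u ⊔ u′ , λ X′ e → min⇓ (h X′ (≈-weaken (m≤m⊔n u u′) e))
      (λ i i<n → h′ i i<n X′ (≈-weaken (m≤n⊔m u u′) e))

  ⇓-use-below : ∀ {k X xs n} {f : Code (suc k)} →
    (∀ i → i < n → ∃[ y ] f [ X ] (i ∷ xs) ⇓ suc y) →
    ∀ i → i < n →
    ∃[ u ] (∀ X′ → X ≈[ u ] X′ → ∃[ y ] f [ X′ ] (i ∷ xs) ⇓ suc y)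
  ⇓-use-below ds i i<n with u , h ← ⇓-use (proj₂ (ds i i<n)) =
    u , λ X′ e → _ , h X′ e

  ⇓-use* : ∀ {j k X xs} {gs : Vec (Code k) j} {ys} →
    Pointwise (λ g y → g [ X ] xs ⇓ y) gs ys →
    ∃[ u ] (∀ X′ → X ≈[ u ] X′ → Pointwise (λ g y → g [ X′ ] xs ⇓ y) gs ys)
  ⇓-use* [] = 0 , λ _ _ → []
  ⇓-use* (d ∷ ds) with u , h ← ⇓-use d | u′ , h′ ← ⇓-use* ds =
    u ⊔ u′ , λ X′ e → h X′ (≈-weaken (m≤m⊔n u u′) e)
                     ∷ h′ X′ (≈-weaken (m≤n⊔m u u′) e)

-- Enumerations of syntax

-- Walks along the antidiagonals, which makes surjectivity an induction on the sum. This is a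
-- different coding from the polynomial one used for relations.
unpair : ℕ → ℕ × ℕ
unpair zero = 0 , 0
unpair (suc n) with unpair n
... | zero , b = suc b , 0
... | suc a , b = a , suc b

unpair-onto : ∀ a b → ∃[ n ] unpair n ≡ (a , b)
unpair-onto a b = diagonal (a + b) a b refl
  where
  diagonal : ∀ s a b → a + b ≡ s → ∃[ n ] unpair n ≡ (a , b)
  diagonal zero zero zero _ = 0 , refl
  diagonal (suc s) (suc a) zero eqn
    with n , h ← diagonal s zero a (trans (sym (+-identityʳ a)) (suc-injective eqn)) =
      suc n , lemma
    where
    lemma : unpair (suc n) ≡ (suc a , 0)
    lemma rewrite h = refl
  diagonal s a (suc b) eqn
    with n , h ← diagonal s (suc a) b (trans (sym (ℕ.+-suc a b)) eqn) = suc n , lemma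
    where
    lemma : unpair (suc n) ≡ (a , suc b)
    lemma rewrite h = refl

-- Needed in the dovetailing: when stage `n` takes up the pair (s , i) that it codes, stage `s` has
-- already been reached.
unpair-≤ : ∀ n → proj₁ (unpair n) + proj₂ (unpair n) ≤ n
unpair-≤ zero = z≤n
unpair-≤ (suc n) with unpair n | unpair-≤ n
... | zero , b | h = s≤s (≤-trans (≤-reflexive (+-identityʳ b)) h)
... | suc a , b | h = ≤-trans (≤-reflexive (ℕ.+-suc a b)) (m≤n⇒m≤1+n h)

-- A common target for all codings of syntax, so that only this one type has to be enumerated by
-- numbers.
data Tree : Set where
  leaf : ℕ → Tree
  node : Tree → Tree → Tree

vectorAt : ∀ l → ℕ → Vec ℕ l
vectorAt zero n = []
vectorAt (suc l) n = proj₁ (unpair n) ∷ vectorAt l (proj₂ (unpair n))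

vectorAt-onto : ∀ {l} (xs : Vec ℕ l) → ∃[ n ] vectorAt l n ≡ xs
vectorAt-onto [] = 0 , refl
vectorAt-onto {suc l} (x ∷ xs) with n , refl ← vectorAt-onto xs
  with m , eqn ← unpair-onto x n =
  m , cong₂ _∷_ (cong proj₁ eqn) (cong (vectorAt l ∘ proj₂) eqn)

-- Postfix notation: 0 applies node to the two topmost stack entries and
-- suc n pushes leaf n.
run : List ℕ → List Tree → Tree
run [] (t ∷ _) = t
run [] [] = leaf 0
run (suc n ∷ is) st = run is (leaf n ∷ st)
run (zero ∷ is) (t ∷ s ∷ st) = run is (node s t ∷ st)
run (zero ∷ is) _ = leaf 0

postfix : Tree → List ℕ → List ℕ
postfix (leaf n) is = suc n ∷ is
postfix (node s t) is = postfix s (postfix t (0 ∷ is))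

run-postfix : ∀ t is st → run (postfix t is) st ≡ run is (t ∷ st)
run-postfix (leaf n) is st = refl
run-postfix (node s t) is st =
  trans (run-postfix s _ st) (run-postfix t _ (s ∷ st))

treeAt : ℕ → Tree
treeAt n =
  run (Vec.toList (vectorAt (proj₁ (unpair n)) (proj₂ (unpair n)))) []

treeAt-onto : ∀ t → ∃[ n ] treeAt n ≡ t
treeAt-onto t
  with m , eqn ← vectorAt-onto (Vec.fromList (postfix t []))
  with n , eqn′ ← unpair-onto (length (postfix t [])) m =
  n , (begin
    treeAt n
      ≡⟨ cong (λ p → run (Vec.toList (vectorAt (proj₁ p) (proj₂ p))) []) eqn′ ⟩
    run (Vec.toList (vectorAt (length (postfix t [])) m)) []
      ≡⟨ cong (λ xs → run (Vec.toList xs) []) eqn ⟩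
    run (Vec.toList (Vec.fromList (postfix t []))) []
      ≡⟨ cong (λ xs → run xs []) (toList∘fromList (postfix t [])) ⟩
    run (postfix t []) []
      ≡⟨ run-postfix t [] [] ⟩
    t ∎)
  where
  open ≡-Reasoning

toFin : ∀ k → ℕ → Fin (suc k)
toFin zero _ = zero
toFin (suc k) zero = zero
toFin (suc k) (suc n) = suc (toFin k n)

toFin∘toℕ : ∀ {k} (i : Fin (suc k)) → toFin k (toℕ i) ≡ i
toFin∘toℕ {zero} zero = refl
toFin∘toℕ {suc k} zero = refl
toFin∘toℕ {suc k} (suc i) = cong suc (toFin∘toℕ i)

decodeList : Tree → List ℕ
decodeList (node (leaf n) t) = n ∷ decodeList t
decodeList _ = []

encodeList : List ℕ → Tree
encodeList [] = leaf 0
encodeList (n ∷ ns) = node (leaf n) (encodeList ns)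

decodeList-encodeList : ∀ ns → decodeList (encodeList ns) ≡ ns
decodeList-encodeList [] = refl
decodeList-encodeList (n ∷ ns) = cong (n ∷_) (decodeList-encodeList ns)

decodeVec : Tree → ∀ k → Vec ℕ k
decodeVec _ zero = []
decodeVec (node (leaf n) t) (suc k) = n ∷ decodeVec t k
decodeVec t (suc k) = 0 ∷ decodeVec t k

encodeVec : ∀ {k} → Vec ℕ k → Tree
encodeVec [] = leaf 0
encodeVec (n ∷ ns) = node (leaf n) (encodeVec ns)

decodeVec-encodeVec : ∀ {k} (ns : Vec ℕ k) → decodeVec (encodeVec ns) k ≡ ns
decodeVec-encodeVec [] = refl
decodeVec-encodeVec (n ∷ ns) = cong (n ∷_) (decodeVec-encodeVec ns)

-- The value of the total decoding on trees that code nothing. At arity 0 it also decodes `zeroᶜ`,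
-- which may therefore share the tree `leaf 0` with `sucᶜ`.
anyCode : ∀ k → Code k
anyCode zero = zeroᶜ
anyCode (suc k) = proj zero

mutual
  -- The arity is an input and is not stored in the tree; only `comp` has to record the arity of its
  -- outer function.
  decodeCode : Tree → ∀ k → Code k
  decodeCode (leaf 0) 1 = sucᶜ
  decodeCode (leaf 1) 1 = oracle
  decodeCode (node (leaf 0) (leaf i)) (suc k) = proj (toFin k i)
  decodeCode (node (leaf 1) (node (leaf j) (node t ts))) k =
    comp (decodeCode t j) (decodeCodes ts j k)
  decodeCode (node (leaf 2) (node s t)) (suc k) =
    prec (decodeCode s k) (decodeCode t (suc (suc k)))
  decodeCode (node (leaf 3) t) k = min (decodeCode t (suc k))
  decodeCode _ k = anyCode k

  decodeCodes : Tree → ∀ j k → Vec (Code k) j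
  decodeCodes _ zero k = []
  decodeCodes (node t ts) (suc j) k = decodeCode t k ∷ decodeCodes ts j k
  decodeCodes (leaf _) (suc j) k = Vec.replicate _ (anyCode k)

mutual
  encodeCode : ∀ {k} → Code k → Tree
  encodeCode zeroᶜ = leaf 0
  encodeCode sucᶜ = leaf 0
  encodeCode oracle = leaf 1
  encodeCode (proj i) = node (leaf 0) (leaf (toℕ i))
  encodeCode (comp {j} f gs) =
    node (leaf 1) (node (leaf j) (node (encodeCode f) (encodeCodes gs)))
  encodeCode (prec f g) = node (leaf 2) (node (encodeCode f) (encodeCode g))
  encodeCode (min f) = node (leaf 3) (encodeCode f)

  encodeCodes : ∀ {j k} → Vec (Code k) j → Tree
  encodeCodes [] = leaf 0
  encodeCodes (g ∷ gs) = node (encodeCode g) (encodeCodes gs)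

mutual
  decodeCode-encodeCode : ∀ {k} (e : Code k) → decodeCode (encodeCode e) k ≡ e
  decodeCode-encodeCode zeroᶜ = refl
  decodeCode-encodeCode sucᶜ = refl
  decodeCode-encodeCode oracle = refl
  decodeCode-encodeCode {suc k} (proj i) = cong proj (toFin∘toℕ i)
  decodeCode-encodeCode (comp f gs) =
    cong₂ comp (decodeCode-encodeCode f) (decodeCodes-encodeCodes gs)
  decodeCode-encodeCode (prec f g) =
    cong₂ prec (decodeCode-encodeCode f) (decodeCode-encodeCode g)
  decodeCode-encodeCode (min f) = cong min (decodeCode-encodeCode f)

  decodeCodes-encodeCodes : ∀ {j k} (gs : Vec (Code k) j) →
    decodeCodes (encodeCodes gs) j k ≡ gs
  decodeCodes-encodeCodes [] = refl
  decodeCodes-encodeCodes (g ∷ gs) =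
    cong₂ _∷_ (decodeCode-encodeCode g) (decodeCodes-encodeCodes gs)

decodeTerm : Tree → ∀ n → Term n
decodeTerm (node (leaf 0) (leaf i)) (suc n) = var (toFin n i)
decodeTerm (leaf 1) n = `1
decodeTerm (node (leaf 1) (node s t)) n = decodeTerm s n `+ decodeTerm t n
decodeTerm (node (leaf 2) (node s t)) n = decodeTerm s n `* decodeTerm t n
decodeTerm _ n = `0

encodeTerm : ∀ {n} → Term n → Tree
encodeTerm (var i) = node (leaf 0) (leaf (toℕ i))
encodeTerm `0 = leaf 0
encodeTerm `1 = leaf 1
encodeTerm (s `+ t) = node (leaf 1) (node (encodeTerm s) (encodeTerm t))
encodeTerm (s `* t) = node (leaf 2) (node (encodeTerm s) (encodeTerm t))

decodeTerm-encodeTerm : ∀ {n} (t : Term n) → decodeTerm (encodeTerm t) n ≡ t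
decodeTerm-encodeTerm {suc n} (var i) = cong var (toFin∘toℕ i)
decodeTerm-encodeTerm `0 = refl
decodeTerm-encodeTerm `1 = refl
decodeTerm-encodeTerm (s `+ t) =
  cong₂ _`+_ (decodeTerm-encodeTerm s) (decodeTerm-encodeTerm t)
decodeTerm-encodeTerm (s `* t) =
  cong₂ _`*_ (decodeTerm-encodeTerm s) (decodeTerm-encodeTerm t)

decodeForm : Tree → ∀ m n → Form m n
decodeForm (node (leaf 0) (node s t)) m n = decodeTerm s n `≡ decodeTerm t n
decodeForm (node (leaf 1) (node s t)) m n = decodeTerm s n `< decodeTerm t n
decodeForm (node (leaf 2) (node t (leaf i))) (suc m) n =
  decodeTerm t n `∈ toFin m i
decodeForm (node (leaf 3) (node s t)) m n = decodeForm s m n `∧ decodeForm t m n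
decodeForm (node (leaf 4) (node s t)) m n = decodeForm s m n `∨ decodeForm t m n
decodeForm (node (leaf 5) (node s t)) m n = decodeForm s m n `⇒ decodeForm t m n
decodeForm (node (leaf 6) t) m n = ∀ⁿ decodeForm t m (suc n)
decodeForm (node (leaf 7) t) m n = ∃ⁿ decodeForm t m (suc n)
decodeForm (node (leaf 8) t) m n = ∀ˢ decodeForm t (suc m) n
decodeForm (node (leaf 9) t) m n = ∃ˢ decodeForm t (suc m) n
decodeForm _ m n = `⊥

encodeForm : ∀ {m n} → Form m n → Tree
encodeForm (s `≡ t) = node (leaf 0) (node (encodeTerm s) (encodeTerm t))
encodeForm (s `< t) = node (leaf 1) (node (encodeTerm s) (encodeTerm t))
encodeForm (t `∈ X) = node (leaf 2) (node (encodeTerm t) (leaf (toℕ X)))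
encodeForm `⊥ = leaf 0
encodeForm (φ `∧ ψ) = node (leaf 3) (node (encodeForm φ) (encodeForm ψ))
encodeForm (φ `∨ ψ) = node (leaf 4) (node (encodeForm φ) (encodeForm ψ))
encodeForm (φ `⇒ ψ) = node (leaf 5) (node (encodeForm φ) (encodeForm ψ))
encodeForm (∀ⁿ φ) = node (leaf 6) (encodeForm φ)
encodeForm (∃ⁿ φ) = node (leaf 7) (encodeForm φ)
encodeForm (∀ˢ φ) = node (leaf 8) (encodeForm φ)
encodeForm (∃ˢ φ) = node (leaf 9) (encodeForm φ)

decodeForm-encodeForm : ∀ {m n} (φ : Form m n) →
                        decodeForm (encodeForm φ) m n ≡ φ
decodeForm-encodeForm (s `≡ t) =
  cong₂ _`≡_ (decodeTerm-encodeTerm s) (decodeTerm-encodeTerm t)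
decodeForm-encodeForm (s `< t) =
  cong₂ _`<_ (decodeTerm-encodeTerm s) (decodeTerm-encodeTerm t)
decodeForm-encodeForm {suc m} (t `∈ X) =
  cong₂ _`∈_ (decodeTerm-encodeTerm t) (toFin∘toℕ X)
decodeForm-encodeForm `⊥ = refl
decodeForm-encodeForm (φ `∧ ψ) =
  cong₂ _`∧_ (decodeForm-encodeForm φ) (decodeForm-encodeForm ψ)
decodeForm-encodeForm (φ `∨ ψ) =
  cong₂ _`∨_ (decodeForm-encodeForm φ) (decodeForm-encodeForm ψ)
decodeForm-encodeForm (φ `⇒ ψ) =
  cong₂ _`⇒_ (decodeForm-encodeForm φ) (decodeForm-encodeForm ψ)
decodeForm-encodeForm (∀ⁿ φ) = cong ∀ⁿ_ (decodeForm-encodeForm φ)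
decodeForm-encodeForm (∃ⁿ φ) = cong ∃ⁿ_ (decodeForm-encodeForm φ)
decodeForm-encodeForm (∀ˢ φ) = cong ∀ˢ_ (decodeForm-encodeForm φ)
decodeForm-encodeForm (∃ˢ φ) = cong ∃ˢ_ (decodeForm-encodeForm φ)

-- The countable families

-- `join` and `code` give the closure of a Turing ideal, `delta` gives Δ⁰₁ comprehension, `graph`
-- puts new solutions into the ideal, and `lift` transfers a set to a longer oracle.
data Decoder : Set where
  char graph natural : Decoder
  lift  : Decoder → Decoder
  join  : Decoder → Decoder → Decoder
  code  : Code 1 → Decoder → Decoder
  delta : ∀ {m n} → Form m (suc n) → Form m (suc n) → Vec ℕ n → Decoder → Decoder

-- `hitU` and `hitV` force infinite sets of the ideal to meet A and B. `extend` is the conjunction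
-- of requirements `i` and `j` over pairs of finite extensions, and `top` fills one side of it when
-- only the other matters.
data Op : Set where
  top       : Op
  hitU hitV : Decoder → Op
  extend    : Decoder → (σ τ lo hi : List ℕ) → Op → Op → Op

decodeDecoder : Tree → Decoder
decodeDecoder (leaf 0) = char
decodeDecoder (leaf 1) = graph
decodeDecoder (node (leaf 0) p) = lift (decodeDecoder p)
decodeDecoder (node (leaf 1) (node p q)) = join (decodeDecoder p) (decodeDecoder q)
decodeDecoder (node (leaf 2) (node e p)) = code (decodeCode e 1) (decodeDecoder p)
decodeDecoder (node (leaf 3) (node (node (leaf m) (leaf n)) (node (node φ ψ) (node ν p)))) =
  delta (decodeForm φ m (suc n)) (decodeForm ψ m (suc n)) (decodeVec ν n)
        (decodeDecoder p)
decodeDecoder _ = natural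

decodeDecoder-onto : ∀ p → ∃[ t ] decodeDecoder t ≡ p
decodeDecoder-onto char = leaf 0 , refl
decodeDecoder-onto graph = leaf 1 , refl
decodeDecoder-onto natural = leaf 2 , refl
decodeDecoder-onto (lift p) with t , refl ← decodeDecoder-onto p =
  node (leaf 0) t , refl
decodeDecoder-onto (join p q)
  with s , refl ← decodeDecoder-onto p | t , refl ← decodeDecoder-onto q =
  node (leaf 1) (node s t) , refl
decodeDecoder-onto (code e p) with t , refl ← decodeDecoder-onto p =
  node (leaf 2) (node (encodeCode e) t) ,
  cong (λ e → code e (decodeDecoder t)) (decodeCode-encodeCode e)
decodeDecoder-onto (delta {m} {n} φ ψ ν p) with t , refl ← decodeDecoder-onto p =
  node (leaf 3) (node (node (leaf m) (leaf n))
    (node (node (encodeForm φ) (encodeForm ψ)) (node (encodeVec ν) t))) ,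
  trans
    (cong₂ (λ φ ψ → delta φ ψ (decodeVec (encodeVec ν) n) (decodeDecoder t))
           (decodeForm-encodeForm φ) (decodeForm-encodeForm ψ))
    (cong (λ ν → delta φ ψ ν (decodeDecoder t)) (decodeVec-encodeVec ν))

decodeOp : Tree → Op
decodeOp (node (leaf 0) p) = hitU (decodeDecoder p)
decodeOp (node (leaf 1) p) = hitV (decodeDecoder p)
decodeOp (node (leaf 2) (node l (node (node (node σ τ) (node lo hi)) (node i j)))) =
  extend (decodeDecoder l) (decodeList σ) (decodeList τ) (decodeList lo)
         (decodeList hi) (decodeOp i) (decodeOp j)
decodeOp _ = top

decodeOp-onto : ∀ i → ∃[ t ] decodeOp t ≡ i
decodeOp-onto top = leaf 0 , refl
decodeOp-onto (hitU p) with t , refl ← decodeDecoder-onto p =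
  node (leaf 0) t , refl
decodeOp-onto (hitV p) with t , refl ← decodeDecoder-onto p =
  node (leaf 1) t , refl
decodeOp-onto (extend l σ τ lo hi i j)
  with t , refl ← decodeDecoder-onto l
     | s , refl ← decodeOp-onto i | r , refl ← decodeOp-onto j =
  node (leaf 2) (node t (node
    (node (node (encodeList σ) (encodeList τ))
          (node (encodeList lo) (encodeList hi))) (node s r))) ,
  trans
    (cong₂ (λ σ τ → extend (decodeDecoder t) σ τ _ _ (decodeOp s) (decodeOp r))
           (decodeList-encodeList σ) (decodeList-encodeList τ))
    (cong₂ (λ lo hi → extend (decodeDecoder t) σ τ lo hi (decodeOp s) (decodeOp r))
           (decodeList-encodeList lo) (decodeList-encodeList hi))

decoderAt : ℕ → Decoder
decoderAt n = decodeDecoder (treeAt n)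

decoderAt-onto : ∀ p → ∃[ n ] decoderAt n ≡ p
decoderAt-onto p with t , refl ← decodeDecoder-onto p
  with n , refl ← treeAt-onto t = n , refl

opAt : ℕ → Op
opAt n = decodeOp (treeAt n)

opAt-onto : ∀ i → ∃[ n ] opAt n ≡ i
opAt-onto i with t , refl ← decodeOp-onto i
  with n , refl ← treeAt-onto t = n , refl

-- Coded pairs, neighbourhoods of oracles and finite extensions

≈-refl : ∀ {a} {A : Set a} {f : ℕ → A} {k} → f ≈[ k ] f
≈-refl _ _ = refl

≈-sym : ∀ {a} {A : Set a} {f g : ℕ → A} {k} → f ≈[ k ] g → g ≈[ k ] f
≈-sym f≈g m m<k = sym (f≈g m m<k)

≈-trans : ∀ {a} {A : Set a} {f g h : ℕ → A} {k} →
          f ≈[ k ] g → g ≈[ k ] h → f ≈[ k ] h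
≈-trans f≈g g≈h m m<k = trans (f≈g m m<k) (g≈h m m<k)

pair : ℕ → ℕ → ℕ
pair x y = (x + y) * (x + y) + x

-- The codes of pairs with sum s lie between s² and s² + s, hence below (s + 1)².
pair-< : ∀ a b {c d} → a + b < c + d → pair a b < pair c d
pair-< a b {c} {d} s<t = begin-strict
  (a + b) * (a + b) + a       ≤⟨ +-monoʳ-≤ ((a + b) * (a + b)) (m≤m+n a b) ⟩
  (a + b) * (a + b) + (a + b) ≡⟨ +-comm ((a + b) * (a + b)) (a + b) ⟩
  suc (a + b) * (a + b)       <⟨ *-monoʳ-< (suc (a + b)) (n<1+n (a + b)) ⟩
  suc (a + b) * suc (a + b)   ≤⟨ *-mono-≤ s<t s<t ⟩
  (c + d) * (c + d)           ≤⟨ m≤m+n _ c ⟩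
  (c + d) * (c + d) + c       ∎
  where open ≤-Reasoning

pair-injective : ∀ {a b c d} → pair a b ≡ pair c d → a ≡ c × b ≡ d
pair-injective {a} {b} {c} {d} e with <-cmp (a + b) (c + d)
... | tri< s<t _ _ = ⊥-elim (<-irrefl e (pair-< a b {c} {d} s<t))
... | tri> _ _ t<s = ⊥-elim (<-irrefl (sym e) (pair-< c d {a} {b} t<s))
... | tri≈ _ s≡t _ with refl ← +-cancelˡ-≡ ((a + b) * (a + b)) a c
                        (trans e (cong (λ s → s * s + c) (sym s≡t))) =
  refl , +-cancelˡ-≡ a b d s≡t

+≤pair : ∀ x y → x + y ≤ pair x y
+≤pair x y with x + y in eqn
... | zero = z≤n
... | suc s = ≤-trans (m≤m*n (suc s) (suc s)) (m≤m+n _ x)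

x≤pair : ∀ x y → x ≤ pair x y
x≤pair x y = ≤-trans (m≤m+n x y) (+≤pair x y)

y≤pair : ∀ x y → y ≤ pair x y
y≤pair x y = ≤-trans (m≤n+m y x) (+≤pair x y)

-- The newest function comes first. In the construction of the ideal the last entry is the generic
-- poset, and the entries before it are monotone sequences added one by one.
Oracle : Set
Oracle = List (ℕ → ℕ)

infix 4 _∼[_]_
_∼[_]_ : Oracle → ℕ → Oracle → Set
Z ∼[ k ] Z′ = List≈.Pointwise (_≈[ k ]_) Z Z′

∼-refl : ∀ {k Z} → Z ∼[ k ] Z
∼-refl = List≈.refl ≈-refl

∼-trans : ∀ {k Z Z′ Z″} → Z ∼[ k ] Z′ → Z′ ∼[ k ] Z″ → Z ∼[ k ] Z″
∼-trans = List≈.transitive ≈-trans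

∼-weaken : ∀ {k k′ Z Z′} → k ≤ k′ → Z ∼[ k′ ] Z′ → Z ∼[ k ] Z′
∼-weaken k≤k′ = List≈.map (≈-weaken k≤k′)

-- The interior of P in the product topology.
Int : (Oracle → Set) → Oracle → Set
Int P Z = ∃[ k ] (∀ Z′ → Z ∼[ k ] Z′ → P Z′)

module _ {Z : Oracle} where

  Int-elim : ∀ {P} → Int P Z → P Z
  Int-elim (k , h) = h Z ∼-refl

  Int-map : ∀ {P Q} → (∀ {Z} → P Z → Q Z) → Int P Z → Int Q Z
  Int-map f (k , h) = k , λ Z′ e → f (h Z′ e)

  Int-pure : ∀ {P} → (∀ {Z} → P Z) → Int P Z
  Int-pure h = 0 , λ _ _ → h

  Int-zip : ∀ {P Q R} → (∀ {Z} → P Z → Q Z → R Z) →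
            Int P Z → Int Q Z → Int R Z
  Int-zip f (k , h) (l , g) = k ⊔ l , λ Z′ e →
    f (h Z′ (∼-weaken (m≤m⊔n k l) e)) (g Z′ (∼-weaken (m≤n⊔m k l) e))

  Int-All : ∀ {A : Set} {P : A → Set} (Q : A → Oracle → Set) →
            (∀ x → P x → Int (Q x) Z) →
            ∀ {xs} → All P xs → Int (λ Z → All (λ x → Q x Z) xs) Z
  Int-All Q h [] = Int-pure []
  Int-All Q h (px ∷ pxs) = Int-zip _∷_ (h _ px) (Int-All Q h pxs)

  Int-AllPairs : ∀ {A : Set} {P : A → A → Set} (Q : A → A → Oracle → Set) →
                 (∀ x y → P x y → Int (Q x y) Z) →
                 ∀ {xs} → AllPairs P xs →
                 Int (λ Z → AllPairs (λ x y → Q x y Z) xs) Z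
  Int-AllPairs Q h [] = Int-pure []
  Int-AllPairs Q h (px ∷ pxs) =
    Int-zip _∷_ (Int-All (Q _) (h _) px) (Int-AllPairs Q h pxs)

-- Finite sequences are listed with the newest entry first; entry i of σ is
-- preceded in time by i others.
at : List ℕ → ℕ → ℕ
at [] _ = 0
at (s ∷ σ) m = if m ≡ᵇ length σ then s else at σ m

infix 4 _extends_
_extends_ : (ℕ → ℕ) → List ℕ → Set
f extends σ = f ≈[ length σ ] at σ

-- The quantifier over `f` stands inside `Int`, so one neighbourhood of `Z` serves all `f` that
-- extend `σ`.
Forces : (Oracle → List ℕ → List ℕ → Set) →
         List ℕ → Oracle → List ℕ → List ℕ → Set
Forces P σ Z R S =
  Int (λ Z′ → ∀ f → f extends σ → P (f ∷ Z′) R S) Z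

Between : (ℕ → ℕ → Set) → List ℕ → List ℕ → ℕ → Set
Between _≺_ lo hi x = All (_≺ x) lo × All (x ≺_) hi

-- The order is a parameter because it is instantiated both by the given order and by what a nearby
-- oracle decodes. Only finitely many comparisons occur; that an interval stays infinite is not an
-- open condition and is left out.
record Extension (_≺_ : ℕ → ℕ → Set) (σ τ lo hi σ′ τ′ : List ℕ) : Set where
  constructor mkExtension
  field
    σ′-between : All (Between _≺_ lo hi) σ′
    τ′-between : All (Between _≺_ lo hi) τ′
    σ′-ascending  : AllPairs (flip _≺_) (σ′ ++ σ)
    τ′-descending : AllPairs _≺_ (τ′ ++ τ)
    separated  : All (λ s → All (s ≺_) τ′) σ′

-- `P m b` reads "`P` outputs `b` at `m`"; `P` may leave values open.
Compatible : (ℕ → ℕ → Set) → Subset → Set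
Compatible P X = ∀ m b → P m b → b ≡ χ X m

-- Column i of X, when X = X₀ ⊕ (X₁ ⊕ (X₂ ⊕ …)).
columnIndex : ∀ {m} → Fin m → ℕ → ℕ
columnIndex zero n = n * 2
columnIndex (suc i) n = suc (columnIndex i n * 2)

columns : ∀ {m} → Subset → Vector Subset m
columns X i n = X (columnIndex i n)

Essential : (List ℕ → List ℕ → Set) → Set
Essential W = ∀ x → ∃[ R ] (All (x <_) R × ∀ y → ∃[ S ] (All (y <_) S × W R S))

-- Meaning of decoders and operations; dependent hyperimmunity

module Semantics (em : ExcludedMiddle 0ℓ) where

  decide : Set → Bool
  decide P = does (em {P})

  decide⁺ : ∀ {P} → P → T (decide P)
  decide⁺ {P} p with em {P}
  ... | yes _ = tt
  ... | no ¬p = ¬p p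

  decide⁻ : ∀ {P} → T (decide P) → P
  decide⁻ {P} t with em {P}
  ... | yes p = p

  relSet : (ℕ → ℕ → Set) → Subset
  relSet P m = decide (∃[ x ] ∃[ y ] (m ≡ pair x y × P x y))

  relSet⁺ : ∀ {P x y} → P x y → Rel (relSet P) x y
  relSet⁺ p = decide⁺ (_ , _ , refl , p)

  relSet⁻ : ∀ {P x y} → Rel (relSet P) x y → P x y
  relSet⁻ {P} {x} {y} t with a , b , e , p ← decide⁻ t
    with refl , refl ← pair-injective {x} {y} {a} {b} e = p

  T-ext : ∀ {b c} → (T b → T c) → (T c → T b) → b ≡ c
  T-ext {true} {true} _ _ = refl
  T-ext {false} {false} _ _ = refl
  T-ext {true} {false} f _ with () ← f tt
  T-ext {false} {true} _ g with () ← g tt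

  -- A code bounds both of its components, so the codes below `k` concern numbers below `k` only.
  relSet-≈ : ∀ {P Q : ℕ → ℕ → Set} {k} →
             (∀ x y → x < k → y < k → (P x y → Q x y) × (Q x y → P x y)) →
             relSet P ≈[ k ] relSet Q
  relSet-≈ {P} {Q} {k} h m m<k =
    T-ext (λ t → decide⁺ (convert (λ x y p q → proj₁ (h x y p q)) (decide⁻ t)))
          (λ t → decide⁺ (convert (λ x y p q → proj₂ (h x y p q)) (decide⁻ t)))
    where
    convert : ∀ {P Q : ℕ → ℕ → Set} → (∀ x y → x < k → y < k → P x y → Q x y) →
              ∃[ x ] ∃[ y ] (m ≡ pair x y × P x y) →
              ∃[ x ] ∃[ y ] (m ≡ pair x y × Q x y)
    convert g (x , y , refl , p) = x , y , refl ,
      g x y (≤-<-trans (x≤pair x y) m<k) (≤-<-trans (y≤pair x y) m<k) p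

  graphSet : (ℕ → ℕ) → Subset
  graphSet f = relSet (λ x y → f x ≡ y)

  graphSet-≈ : ∀ {f g k} → f ≈[ k ] g → graphSet f ≈[ k ] graphSet g
  graphSet-≈ e = relSet-≈ λ x y x<k _ → trans (sym (e x x<k)) , trans (e x x<k)

  naturalOrder : Subset
  naturalOrder = relSet _<_

  -- Near an oracle that decodes a total set, `p` may decode only a part of it. Quantifying over all
  -- compatible `X` in `code` and `delta` keeps the values that this part already secures.
  ⟦_⟧ᴰ : Decoder → Oracle → ℕ → ℕ → Set
  ⟦ char ⟧ᴰ (f ∷ Z) m b = b ≡ f m
  ⟦ graph ⟧ᴰ (f ∷ Z) m b = b ≡ χ (graphSet f) m
  ⟦ lift p ⟧ᴰ (f ∷ Z) = ⟦ p ⟧ᴰ Z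
  ⟦ natural ⟧ᴰ Z m b = b ≡ χ naturalOrder m
  ⟦ join p q ⟧ᴰ Z m b =
    if m % 2 ≡ᵇ 0 then ⟦ p ⟧ᴰ Z (m / 2) b else ⟦ q ⟧ᴰ Z (m / 2) b
  ⟦ code e p ⟧ᴰ Z m b = ∀ X → Compatible (⟦ p ⟧ᴰ Z) X → e [ X ] (m ∷ []) ⇓ b
  -- The empty second order part is harmless: `delta` gets applied to Σ⁰₁ and Π⁰₁ formulas, which
  -- have no set quantifiers.
  ⟦ delta φ ψ ν p ⟧ᴰ Z m b = ∀ X → Compatible (⟦ p ⟧ᴰ Z) X →
      b ≡ 1 × Sat (λ _ → ⊥) (columns X) (m Env.∷ Vec.lookup ν) φ
    ⊎ b ≡ 0 × ¬ Sat (λ _ → ⊥) (columns X) (m Env.∷ Vec.lookup ν) ψ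
  ⟦ _ ⟧ᴰ [] _ _ = ⊥

  ⟦_⟧ᴼ : Op → Oracle → List ℕ → List ℕ → Set
  ⟦ top ⟧ᴼ Z U V = ⊤
  ⟦ hitU p ⟧ᴼ Z U V = ∃[ h ] (h ∈ U × ⟦ p ⟧ᴰ Z h 1)
  ⟦ hitV p ⟧ᴼ Z U V = ∃[ h ] (h ∈ V × ⟦ p ⟧ᴰ Z h 1)
  -- Both lists are split in two: if U is in A and V is in B, the same is true of the parts, and so
  -- `i` and `j` are met at once.
  ⟦ extend l σ τ lo hi i j ⟧ᴼ Z U V =
    ∃[ σ′ ] ∃[ τ′ ]
      (Extension (λ x y → ⟦ l ⟧ᴰ Z (pair x y) 1) σ τ lo hi σ′ τ′ ×
       ∃[ R ] ∃[ S ] ∃[ R′ ] ∃[ S′ ]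
         (U ≡ R ++ R′ × V ≡ S ++ S′ ×
          Forces ⟦ i ⟧ᴼ (σ′ ++ σ) Z R S × Forces ⟦ j ⟧ᴼ (τ′ ++ τ) Z R′ S′))

  Holds : Op → Oracle → List ℕ → List ℕ → Set
  Holds i Z R S = Int (λ Z′ → ⟦ i ⟧ᴼ Z′ R S) Z

  -- Correctness is asked at `Z` itself, whereas each value of `X` must be output on a whole
  -- neighbourhood of `Z`.
  Reduces : Decoder → Oracle → Subset → Set
  Reduces p Z X = Compatible (⟦ p ⟧ᴰ Z) X ×
                  ∀ m → Int (λ Z′ → ⟦ p ⟧ᴰ Z′ m (χ X m)) Z

  -- Dependent hyperimmunity of the pair of complements of A and B, relative
  -- to Z.
  DependentlyHyperimmune : (A B : ℕ → Set) → Oracle → Set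
  DependentlyHyperimmune A B Z = ∀ i → Essential (Holds i Z) →
    ∃[ R ] ∃[ S ] (All A R × All B S × Holds i Z R S)

at-++ : ∀ σ′ {σ m} → m < length σ → at (σ′ ++ σ) m ≡ at σ m
at-++ [] _ = refl
at-++ (s ∷ σ′) {σ} {m} m<l with m ≡ᵇ length (σ′ ++ σ) in e
... | false = at-++ σ′ m<l
... | true = ⊥-elim (<-irrefl (≡ᵇ⇒≡ m _ (subst T (sym e) tt))
    (<-≤-trans m<l (≤-trans (m≤n+m (length σ) (length σ′))
                            (≤-reflexive (sym (length-++ σ′))))))

length-++-≤ : ∀ (σ′ σ : List ℕ) → length σ ≤ length (σ′ ++ σ)
length-++-≤ σ′ σ =
  ≤-trans (m≤n+m (length σ) (length σ′)) (≤-reflexive (sym (length-++ σ′)))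

at-All : ∀ {P : ℕ → Set} {σ m} → All P σ → m < length σ → P (at σ m)
at-All {P} {s ∷ σ} {m} (ps ∷ pσ) m<l with m ≡ᵇ length σ in e
... | true = ps
... | false = at-All pσ (≤∧≢⇒< (s≤s⁻¹ m<l) λ { refl →
    subst T e (≡⇒≡ᵇ m m refl) })

at-AllPairs : ∀ {R : ℕ → ℕ → Set} {σ k l} → AllPairs (flip R) σ →
              k < l → l < length σ → R (at σ k) (at σ l)
at-AllPairs {R} {s ∷ σ} {k} {l} (as ∷ aσ) k<l l<n
  with k ≡ᵇ length σ in e | l ≡ᵇ length σ in e′
... | true | _ = ⊥-elim (<-irrefl (≡ᵇ⇒≡ k _ (subst T (sym e) tt))
                        (<-≤-trans k<l (s≤s⁻¹ l<n)))
... | false | true = at-All as (<-≤-trans k<l (s≤s⁻¹ l<n))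
... | false | false = at-AllPairs aσ k<l (≤∧≢⇒< (s≤s⁻¹ l<n) λ { refl →
    subst T e′ (≡⇒≡ᵇ l l refl) })

Inessential : (List ℕ → List ℕ → Set) → Set
Inessential W =
  ∃[ x ] (∀ R → All (x <_) R → ∃[ y ] (∀ S → All (y <_) S → ¬ W R S))

Infinite : (ℕ → Set) → Set
Infinite P = ∀ m → ∃[ x ] (m < x × P x)

Infinite-⊆ : ∀ {P Q : ℕ → Set} → (∀ {x} → P x → Q x) → Infinite P → Infinite Q
Infinite-⊆ f h m with x , m<x , p ← h m = x , m<x , f p

module _ (em : ExcludedMiddle 0ℓ) where

  dne : {P : Set} → ¬ ¬ P → P
  dne {P} ¬¬p with em {P}
  ... | yes p = p
  ... | no ¬p = ⊥-elim (¬¬p ¬p)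

  ¬∀⇒∃¬ : {A : Set} {P : A → Set} → ¬ (∀ x → P x) → ∃[ x ] ¬ P x
  ¬∀⇒∃¬ ¬∀ = dne λ ¬∃ → ¬∀ λ x → dne λ ¬p → ¬∃ (x , ¬p)

  essential? : ∀ W → Essential W ⊎ Inessential W
  essential? W with em {Inessential W}
  ... | yes h = inj₂ h
  ... | no ¬h = inj₁ λ x → dne λ ¬R → ¬h (x , λ R x<R →
    dne λ ¬y → ¬R (R , x<R , λ y → dne λ ¬S → ¬y (y , λ S y<S w →
      ¬S (S , y<S , w))))

  Infinite-∪ : {P Q R : ℕ → Set} → (∀ {x} → P x → Q x ⊎ R x) →
               Infinite P → Infinite Q ⊎ Infinite R
  Infinite-∪ {P} {Q} {R} split inf with em {Infinite Q}
  ... | yes infQ = inj₁ infQ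
  ... | no ¬infQ with m , ¬q ← ¬∀⇒∃¬ ¬infQ = inj₂ λ k → pick k (inf (m ⊔ k))
    where
    pick : ∀ k → ∃[ x ] (m ⊔ k < x × P x) → ∃[ x ] (k < x × R x)
    pick k (x , k<x , p) with split p
    ... | inj₁ q = ⊥-elim (¬q (x , ≤-<-trans (m≤m⊔n m k) k<x , q))
    ... | inj₂ r = x , ≤-<-trans (m≤n⊔m m k) k<x , r

Inessential-⊆ : ∀ {W W′ : List ℕ → List ℕ → Set} →
                (∀ {R S} → W′ R S → W R S) → Inessential W → Inessential W′
Inessential-⊆ f (x , h) = x , λ R x<R → map₂ (λ g S y<S w → g S y<S (f w)) (h R x<R)

-- Generic sequences

module _ (em : ExcludedMiddle 0ℓ) (A B : ℕ → Set) where
  open Semantics em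

  private
    DH = DependentlyHyperimmune A B

  Met : Op → List ℕ → Oracle → Set
  Met i σ Z = ∃[ R ] ∃[ S ] (All A R × All B S × Forces ⟦ i ⟧ᴼ σ Z R S)

  -- The conditions are abstract because the construction is run twice on the same conditions, once
  -- reading off the ascending sequence and once the descending one.
  module Forcing
    {C : Set} (_⊑_ : C → C → Set)
    (⊑-refl : ∀ {p} → p ⊑ p) (⊑-trans : ∀ {p q r} → r ⊑ q → q ⊑ p → r ⊑ p)
    (seq : C → List ℕ)
    (seq-⊑ : ∀ {p q} → q ⊑ p → ∃[ σ ] seq q ≡ σ ++ seq p)
    (Z : Oracle)
    where

    -- The second alternative makes the relation inessential for every sequence built below `p`, so
    -- that hyperimmunity demands nothing there.
    Handles : Op → C → Set
    Handles i p = Met i (seq p) Z ⊎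
      Inessential (λ R S → ∃[ q ] (q ⊑ p × Forces ⟦ i ⟧ᴼ (seq q) Z R S))

    Progress : Op → C → Set
    Progress i p =
      ∃[ q ] (q ⊑ p × length (seq p) < length (seq q) × Handles i q)

    seq-at : ∀ {p q m} → q ⊑ p → m < length (seq p) → at (seq q) m ≡ at (seq p) m
    seq-at q⊑p m<l with σ , e ← seq-⊑ q⊑p =
      trans (cong (λ τ → at τ _) e) (at-++ σ m<l)

    length-⊑ : ∀ {p q} → q ⊑ p → length (seq p) ≤ length (seq q)
    length-⊑ {p} {q} q⊑p with σ , e ← seq-⊑ q⊑p =
      ≤-trans (length-++-≤ σ (seq p)) (≤-reflexive (cong length (sym e)))

    module _ (p₀ : C) (progress : ∀ p → p ⊑ p₀ → ∀ i → Progress i p) where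

      stage : ℕ → ∃[ p ] p ⊑ p₀
      step : ∀ n → Progress (opAt n) (proj₁ (stage n))
      stage zero = p₀ , ⊑-refl
      stage (suc n) with q , q⊑p , _ ← step n =
        q , ⊑-trans q⊑p (proj₂ (stage n))
      step n with p , p⊑p₀ ← stage n = progress p p⊑p₀ (opAt n)

      cond : ℕ → C
      cond n = proj₁ (stage n)

      cond-step : ∀ n → cond (suc n) ⊑ cond n
      cond-step n = proj₁ (proj₂ (step n))

      cond-⊑ : ∀ {m n} → m ≤′ n → cond n ⊑ cond m
      cond-⊑ ≤′-refl = ⊑-refl
      cond-⊑ (≤′-step {n} m≤n) = ⊑-trans (cond-step n) (cond-⊑ m≤n)

      length-cond : ∀ n → n ≤ length (seq (cond n))
      length-cond zero = z≤n
      length-cond (suc n) =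
        ≤-<-trans (length-cond n) (proj₁ (proj₂ (proj₂ (step n))))

      limit : ℕ → ℕ
      -- Stage m + 1 is the first at which length at least m + 1, and hence an entry `m`, is
      -- guaranteed.
      limit m = at (seq (cond (suc m))) m

      limit-extends : ∀ n → limit extends seq (cond n)
      limit-extends n m m<l with ≤-total (suc m) n
      ... | inj₁ m<n = sym (seq-at (cond-⊑ (≤⇒≤′ m<n)) (length-cond (suc m)))
      ... | inj₂ n≤m = seq-at (cond-⊑ (≤⇒≤′ n≤m)) m<l

      limit-hyperimmune : DH (limit ∷ Z)
      limit-hyperimmune i ess with n , refl ← opAt-onto i
        with proj₂ (proj₂ (proj₂ (step n)))
      ... | inj₁ (R , S , aR , bS , k , h) = R , S , aR , bS ,
        -- Besides `k` for the old oracle, agreement along all of `σ` is needed for the new function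
        -- `f` to extend `σ`.
        k ⊔ length σ , λ { (f ∷ Z′) (e ∷ es) →
          h Z′ (∼-weaken (m≤m⊔n k _) es) f
            (≈-trans (≈-sym (≈-weaken (m≤n⊔m k _) e)) (limit-extends (suc n))) }
        where σ = seq (cond (suc n))
      ... | inj₂ (x , h) with R , x<R , ess-R ← ess x
        with y , h-R ← h R x<R
        with S , y<S , k , holds ← ess-R y =
        -- What holds at precision `k` around the limit is forced by any stage whose sequence has
        -- length at least `k`. Such a stage after `n` contradicts the inessentiality recorded at
        -- stage `n`.
        ⊥-elim (h-R S y<S (cond (suc n ⊔ k) , cond-⊑ (≤⇒≤′ (m≤m⊔n (suc n) k)) ,
          k , λ Z′ e f f-ext → holds (f ∷ Z′)
            (≈-trans (≈-weaken (≤-trans (m≤n⊔m (suc n) k)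
                                        (length-cond (suc n ⊔ k)))
                       (limit-extends (suc n ⊔ k)))
                     (≈-sym (≈-weaken (≤-trans (m≤n⊔m (suc n) k)
                                        (length-cond (suc n ⊔ k))) f-ext)) ∷ e)))

      generic : ∃[ f ] (DH (f ∷ Z) ×
                        ∀ k → ∃[ p ] (f extends seq p × k < length (seq p)))
      generic = limit , limit-hyperimmune , λ k →
        cond (suc k) , limit-extends (suc k) , length-cond (suc k)

-- Ascending and descending sequences

IsStrictLinear : (ℕ → ℕ → Set) → Set
IsStrictLinear _≺_ =
    (∀ x → ¬ (x ≺ x))
  × (∀ x y z → x ≺ y → y ≺ z → x ≺ z)
  × (∀ x y → x ≺ y ⊎ x ≡ y ⊎ y ≺ x)

-- `≺-open` and `≺-sound` express that `l` decodes the order from `Z`; only true comparisons have to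
-- persist near `Z`.
module Sequence
  (em : ExcludedMiddle 0ℓ) (A B : ℕ → Set)
  {Z : Oracle} (hyperimmune : Semantics.DependentlyHyperimmune em A B Z) (l : Decoder)
  (_≺_ : ℕ → ℕ → Set) (linear : IsStrictLinear _≺_)
  (≺-open : ∀ x y → x ≺ y → Int (λ Z′ → Semantics.⟦_⟧ᴰ em l Z′ (pair x y) 1) Z)
  (≺-sound : ∀ x y → Semantics.⟦_⟧ᴰ em l Z (pair x y) 1 → x ≺ y)
  where

  open Semantics em

  private
    DH = DependentlyHyperimmune A B
    transitive = proj₁ (proj₂ linear)
    total = proj₂ (proj₂ linear)

  _≺[_]_ : ℕ → Oracle → ℕ → Set
  x ≺[ Z′ ] y = ⟦ l ⟧ᴰ Z′ (pair x y) 1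

  ⟨_,_⟩ : List ℕ → List ℕ → ℕ → Set
  ⟨ lo , hi ⟩ = Between _≺_ lo hi

  -- The bounds `lo` and `hi` are kept apart from `σ` and `τ`, since the interval may be cut down
  -- without adding to either sequence.
  record Cond : Set where
    field
      σ τ lo hi  : List ℕ
      ascending  : AllPairs (flip _≺_) σ
      descending : AllPairs _≺_ τ
      above-σ    : ∀ {x} → ⟨ lo , hi ⟩ x → All (_≺ x) σ
      below-τ    : ∀ {x} → ⟨ lo , hi ⟩ x → All (x ≺_) τ
      infinite   : Infinite ⟨ lo , hi ⟩
  open Cond

  record _⊑_ (q p : Cond) : Set where
    field
      σ′ τ′ : List ℕ
      σ-ext : σ q ≡ σ′ ++ σ p
      τ-ext : τ q ≡ τ′ ++ τ p
      σ′-between : All ⟨ lo p , hi p ⟩ σ′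
      τ′-between : All ⟨ lo p , hi p ⟩ τ′
      shrink : ∀ {x} → ⟨ lo q , hi q ⟩ x →
               ⟨ σ′ ++ lo p , τ′ ++ hi p ⟩ x

  between-++ : ∀ σ′ τ′ {lo hi x} → ⟨ σ′ ++ lo , τ′ ++ hi ⟩ x → ⟨ lo , hi ⟩ x
  between-++ σ′ τ′ (lo< , <hi) = All.++⁻ʳ σ′ lo< , All.++⁻ʳ τ′ <hi

  ⊑-refl : ∀ {p} → p ⊑ p
  ⊑-refl = record
    { σ′ = [] ; τ′ = [] ; σ-ext = refl ; τ-ext = refl
    ; σ′-between = [] ; τ′-between = [] ; shrink = λ b → b }

  ⊑-trans : ∀ {p q r} → r ⊑ q → q ⊑ p → r ⊑ p
  ⊑-trans {p} {q} {r} r⊑q q⊑p = record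
    { σ′ = R.σ′ ++ Q.σ′
    ; τ′ = R.τ′ ++ Q.τ′
    ; σ-ext = trans R.σ-ext (trans (cong (R.σ′ ++_) Q.σ-ext)
                                   (sym (++-assoc R.σ′ Q.σ′ (σ p))))
    ; τ-ext = trans R.τ-ext (trans (cong (R.τ′ ++_) Q.τ-ext)
                                   (sym (++-assoc R.τ′ Q.τ′ (τ p))))
    ; σ′-between = All.++⁺ (All.map (between-++ Q.σ′ Q.τ′ ∘ Q.shrink) R.σ′-between)
                           Q.σ′-between
    ; τ′-between = All.++⁺ (All.map (between-++ Q.σ′ Q.τ′ ∘ Q.shrink) R.τ′-between)
                           Q.τ′-between
    ; shrink = λ b →
        let lo< , <hi = R.shrink b
            lo<′ , <hi′ = Q.shrink (between-++ R.σ′ R.τ′ (lo< , <hi))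
        in subst (All _) (sym (++-assoc R.σ′ Q.σ′ (lo p)))
             (All.++⁺ (All.++⁻ˡ R.σ′ lo<) lo<′) ,
           subst (All _) (sym (++-assoc R.τ′ Q.τ′ (hi p)))
             (All.++⁺ (All.++⁻ˡ R.τ′ <hi) <hi′)
    }
    where
    module R = _⊑_ r⊑q
    module Q = _⊑_ q⊑p

  module Asc = Forcing em A B _⊑_ ⊑-refl ⊑-trans σ
    (λ q⊑p → _⊑_.σ′ q⊑p , _⊑_.σ-ext q⊑p) Z
  module Desc = Forcing em A B _⊑_ ⊑-refl ⊑-trans τ
    (λ q⊑p → _⊑_.τ′ q⊑p , _⊑_.τ-ext q⊑p) Z

  add-σ : ∀ p σ′ → All ⟨ lo p , hi p ⟩ σ′ → AllPairs (flip _≺_) (σ′ ++ σ p) →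
          Infinite ⟨ σ′ ++ lo p , hi p ⟩ →
          Σ Cond λ q → q ⊑ p × σ q ≡ σ′ ++ σ p
                     × lo q ≡ σ′ ++ lo p × hi q ≡ hi p
  add-σ p σ′ btw asc inf = record
    { σ = σ′ ++ σ p ; τ = τ p ; lo = σ′ ++ lo p ; hi = hi p
    ; ascending = asc ; descending = descending p
    ; above-σ = λ b → All.++⁺ (All.++⁻ˡ σ′ (proj₁ b))
                              (above-σ p (between-++ σ′ [] b))
    ; below-τ = λ b → below-τ p (between-++ σ′ [] b)
    ; infinite = inf
    } , record
    { σ′ = σ′ ; τ′ = [] ; σ-ext = refl ; τ-ext = refl
    ; σ′-between = btw ; τ′-between = [] ; shrink = λ b → b } ,
    refl , refl , refl

  add-τ : ∀ p τ′ → All ⟨ lo p , hi p ⟩ τ′ → AllPairs _≺_ (τ′ ++ τ p) →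
          Infinite ⟨ lo p , τ′ ++ hi p ⟩ →
          Σ Cond λ q → q ⊑ p × τ q ≡ τ′ ++ τ p
                     × lo q ≡ lo p × hi q ≡ τ′ ++ hi p
  add-τ p τ′ btw desc inf = record
    { σ = σ p ; τ = τ′ ++ τ p ; lo = lo p ; hi = τ′ ++ hi p
    ; ascending = ascending p ; descending = desc
    ; above-σ = λ b → above-σ p (between-++ [] τ′ b)
    ; below-τ = λ b → All.++⁺ (All.++⁻ˡ τ′ (proj₂ b))
                              (below-τ p (between-++ [] τ′ b))
    ; infinite = inf
    } , record
    { σ′ = [] ; τ′ = τ′ ; σ-ext = refl ; τ-ext = refl
    ; σ′-between = [] ; τ′-between = btw ; shrink = λ b → b } ,
    refl , refl , refl

  narrow : ∀ p lo′ hi′ → (∀ {x} → ⟨ lo′ , hi′ ⟩ x → ⟨ lo p , hi p ⟩ x) →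
           Infinite ⟨ lo′ , hi′ ⟩ →
           Σ Cond λ q → q ⊑ p × σ q ≡ σ p × τ q ≡ τ p × lo q ≡ lo′ × hi q ≡ hi′
  narrow p lo′ hi′ sub inf = record
    { σ = σ p ; τ = τ p ; lo = lo′ ; hi = hi′
    ; ascending = ascending p ; descending = descending p
    ; above-σ = λ b → above-σ p (sub b)
    ; below-τ = λ b → below-τ p (sub b)
    ; infinite = inf
    } , record
    { σ′ = [] ; τ′ = [] ; σ-ext = refl ; τ-ext = refl
    ; σ′-between = [] ; τ′-between = [] ; shrink = sub } ,
    refl , refl , refl , refl

  -- The pairs (R , S) that can be made true by adding to σ (to τ) finitely
  -- many elements of ⟨ lo , hi ⟩ beyond which that interval stays infinite.
  AscendingReach DescendingReach :
    Cond → List ℕ → List ℕ → Op → List ℕ → List ℕ → Set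
  AscendingReach p lo hi i R S = ∃[ σ′ ]
    (All ⟨ lo , hi ⟩ σ′ × AllPairs (flip _≺_) (σ′ ++ σ p) ×
     Infinite ⟨ σ′ ++ lo , hi ⟩ × Forces ⟦ i ⟧ᴼ (σ′ ++ σ p) Z R S)
  DescendingReach p lo hi j R S = ∃[ τ′ ]
    (All ⟨ lo , hi ⟩ τ′ × AllPairs _≺_ (τ′ ++ τ p) ×
     Infinite ⟨ lo , τ′ ++ hi ⟩ × Forces ⟦ j ⟧ᴼ (τ′ ++ τ p) Z R S)

  -- The same `k` serves at every `Z′` near `Z`, because agreement up to `k` is transitive.
  Forces-open : ∀ P σ R S → Forces P σ Z R S → Int (λ Z′ → Forces P σ Z′ R S) Z
  Forces-open P σ R S (k , h) = k , λ Z′ e → k , λ Z″ e′ → h Z″ (∼-trans e e′)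

  Between-open : ∀ lo hi x → ⟨ lo , hi ⟩ x →
                 Int (λ Z′ → Between (_≺[ Z′ ]_) lo hi x) Z
  Between-open lo hi x (lo< , <hi) =
    Int-zip _,_ (Int-All (λ y Z′ → y ≺[ Z′ ] x) (λ y → ≺-open y x) lo<)
                (Int-All (λ y Z′ → x ≺[ Z′ ] y) (≺-open x) <hi)

  Extension-open : ∀ σ τ lo hi σ′ τ′ → Extension _≺_ σ τ lo hi σ′ τ′ →
                   Int (λ Z′ → Extension (_≺[ Z′ ]_) σ τ lo hi σ′ τ′) Z
  Extension-open σ τ lo hi σ′ τ′ ext =
    Int-zip (λ (a , b) (c , d , e) → mkExtension a b c d e)
      (Int-zip _,_ (between σ′-between) (between τ′-between))
      (Int-zip _,_ (Int-AllPairs (λ y x Z′ → x ≺[ Z′ ] y) (flip ≺-open) σ′-ascending)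
        (Int-zip _,_ (Int-AllPairs (λ x y Z′ → x ≺[ Z′ ] y) ≺-open τ′-descending)
          (Int-All (λ s Z′ → All (λ t → s ≺[ Z′ ] t) τ′)
            (λ s → Int-All (λ t Z′ → s ≺[ Z′ ] t) (≺-open s)) separated)))
    where
    open Extension ext
    between : ∀ {xs} → All ⟨ lo , hi ⟩ xs →
              Int (λ Z′ → All (Between (_≺[ Z′ ]_) lo hi) xs) Z
    between = Int-All (λ x Z′ → Between (_≺[ Z′ ]_) lo hi x) (Between-open lo hi)

  Extension-sound : ∀ σ τ lo hi σ′ τ′ → Extension (_≺[ Z ]_) σ τ lo hi σ′ τ′ →
                    Extension _≺_ σ τ lo hi σ′ τ′
  Extension-sound σ τ lo hi σ′ τ′ (mkExtension a b c d e) = mkExtension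
    (All.map between a) (All.map between b)
    (AllPairs.map (λ {y} {x} → ≺-sound x y) c) (AllPairs.map (λ {x} {y} → ≺-sound x y) d)
    (All.map (λ {s} → All.map (λ {t} → ≺-sound s t)) e)
    where
    between : ∀ {x} → Between (_≺[ Z ]_) lo hi x → ⟨ lo , hi ⟩ x
    between {x} (a , b) =
      All.map (λ {y} → ≺-sound y x) a , All.map (λ {y} → ≺-sound x y) b

  -- Witnesses for the two essential relations are concatenated, and hyperimmunity of `Z` is applied
  -- to the single operation `extend`. The extensions it returns may differ from those used to prove
  -- essentiality, so nothing about infinite intervals survives; what survives is the separation of
  -- `σ′` from `τ′`.
  joint-extension : ∀ p i j lo₁ hi₁ lo₂ hi₂ →
    (∀ {x} → ⟨ lo₁ , hi₁ ⟩ x → ⟨ lo p , hi p ⟩ x) →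
    (∀ {x} → ⟨ lo₂ , hi₂ ⟩ x → ⟨ lo p , hi p ⟩ x) →
    (∀ {s t} → ⟨ lo₁ , hi₁ ⟩ s → Infinite ⟨ s ∷ lo₁ , hi₁ ⟩ →
               ⟨ lo₂ , hi₂ ⟩ t → Infinite ⟨ lo₂ , t ∷ hi₂ ⟩ → s ≺ t) →
    Essential (AscendingReach p lo₁ hi₁ i) →
    Essential (DescendingReach p lo₂ hi₂ j) →
    ∃[ σ′ ] ∃[ τ′ ] (Extension _≺_ (σ p) (τ p) (lo p) (hi p) σ′ τ′
                     × Met em A B i (σ′ ++ σ p) Z × Met em A B j (τ′ ++ τ p) Z)
  joint-extension p i j lo₁ hi₁ lo₂ hi₂ sub₁ sub₂ sep ess₁ ess₂ =
    meet (hyperimmune (extend l (σ p) (τ p) (lo p) (hi p) i j) essential)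
    where
    meet : ∃[ U ] ∃[ V ] (All A U × All B V ×
             Holds (extend l (σ p) (τ p) (lo p) (hi p) i j) Z U V) → _
    meet (U , V , aU , bV , holds)
      with σ′ , τ′ , ext , R , S , R′ , S′ , refl , refl , fσ , fτ ←
             Int-elim holds =
      σ′ , τ′ , Extension-sound _ _ _ _ σ′ τ′ ext ,
      (R , S , All.++⁻ˡ R aU , All.++⁻ˡ S bV , fσ) ,
      (R′ , S′ , All.++⁻ʳ R aU , All.++⁻ʳ S bV , fτ)
    essential : Essential (Holds (extend l (σ p) (τ p) (lo p) (hi p) i j) Z)
    essential x with R , x<R , ess-R ← ess₁ x | R′ , x<R′ , ess-R′ ← ess₂ x =
      R ++ R′ , All.++⁺ x<R x<R′ , λ y →
        let S , y<S , σ′ , btw , asc , inf , fσ = ess-R y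
            S′ , y<S′ , τ′ , btw′ , desc , inf′ , fτ = ess-R′ y
            -- The hypothesis `sep` speaks of single elements; each inherits its infinite interval
            -- from that of the whole extension.
            drop : ∀ {s σ′} → s ∈ σ′ → Infinite ⟨ σ′ ++ lo₁ , hi₁ ⟩ →
                   Infinite ⟨ s ∷ lo₁ , hi₁ ⟩
            drop s∈ = Infinite-⊆ λ {x} b →
              All.lookup (All.++⁻ˡ _ (proj₁ b)) s∈ ∷ All.++⁻ʳ _ (proj₁ b) , proj₂ b
            drop′ : ∀ {t τ′} → t ∈ τ′ → Infinite ⟨ lo₂ , τ′ ++ hi₂ ⟩ →
                    Infinite ⟨ lo₂ , t ∷ hi₂ ⟩
            drop′ t∈ = Infinite-⊆ λ {x} b →
              proj₁ b , All.lookup (All.++⁻ˡ _ (proj₂ b)) t∈ ∷ All.++⁻ʳ _ (proj₂ b)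
            ext = mkExtension (All.map sub₁ btw) (All.map sub₂ btw′) asc desc
              (All.tabulate λ s∈ → All.tabulate λ t∈ →
                sep (All.lookup btw s∈) (drop s∈ inf)
                    (All.lookup btw′ t∈) (drop′ t∈ inf′))
        in S ++ S′ , All.++⁺ y<S y<S′ ,
           Int-zip (λ e (f , g) → σ′ , τ′ , e , R , S , R′ , S′ , refl , refl , f , g)
             (Extension-open _ _ _ _ σ′ τ′ ext)
             (Int-zip _,_ (Forces-open ⟦ i ⟧ᴼ (σ′ ++ σ p) R S fσ)
                         (Forces-open ⟦ j ⟧ᴼ (τ′ ++ τ p) R′ S′ fτ))

  Split : Cond → ℕ → Set
  Split p z = ⟨ lo p , hi p ⟩ z × Infinite ⟨ lo p , z ∷ hi p ⟩
                                × Infinite ⟨ z ∷ lo p , hi p ⟩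

  infinite-side : ∀ p z → Infinite ⟨ lo p , z ∷ hi p ⟩ ⊎ Infinite ⟨ z ∷ lo p , hi p ⟩
  -- Searching beyond `m ⊔ z` excludes `z` itself, the one element on neither side.
  infinite-side p z = Sum.map₂ (λ inf m → pick m (inf (m ⊔ z)))
                               (Infinite-∪ em side (infinite p))
    where
    side : ∀ {x} → ⟨ lo p , hi p ⟩ x →
           ⟨ lo p , z ∷ hi p ⟩ x ⊎ x ≡ z ⊎ ⟨ z ∷ lo p , hi p ⟩ x
    side {x} (a , b) with total x z
    ... | inj₁ x≺z = inj₁ (a , x≺z ∷ b)
    ... | inj₂ (inj₁ x≡z) = inj₂ (inj₁ x≡z)
    ... | inj₂ (inj₂ z≺x) = inj₂ (inj₂ (z≺x ∷ a , b))
    pick : ∀ m → ∃[ x ] (m ⊔ z < x × (x ≡ z ⊎ ⟨ z ∷ lo p , hi p ⟩ x)) →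
           ∃[ x ] (m < x × ⟨ z ∷ lo p , hi p ⟩ x)
    pick m (x , m<x , inj₁ refl) = ⊥-elim (<-irrefl refl (≤-<-trans (m≤n⊔m m z) m<x))
    pick m (x , m<x , inj₂ b) = x , ≤-<-trans (m≤m⊔n m z) m<x , b

  -- Once the interval is narrowed to `lo′` and `hi′`, every condition below the result has its new
  -- part of `σ` inside that interval with an infinite rest, and is therefore counted by
  -- `AscendingReach`.
  ascending-avoids : ∀ {p i lo′ hi′} →
    (∀ {x} → ⟨ lo′ , hi′ ⟩ x → ⟨ lo p , hi p ⟩ x) → Infinite ⟨ lo′ , hi′ ⟩ →
    Inessential (AscendingReach p lo′ hi′ i) → ∃[ q ] (q ⊑ p × Asc.Handles i q)
  ascending-avoids {p} {i} {lo′} {hi′} sub inf avoid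
    with q , q⊑p , refl , refl , refl , refl ← narrow p _ _ sub inf =
    q , q⊑p , inj₂ (Inessential-⊆ reach avoid)
    where
    reach : ∀ {R S} → ∃[ r ] (r ⊑ q × Forces ⟦ i ⟧ᴼ (σ r) Z R S) →
            AscendingReach p lo′ hi′ i R S
    reach {R} {S} (r , r⊑q , f) = σ′ , σ′-between ,
      subst (AllPairs _) σ-ext (ascending r) ,
      Infinite-⊆ (λ b → between-++ [] τ′ (shrink b)) (infinite r) ,
      subst (λ ρ → Forces ⟦ i ⟧ᴼ ρ Z R S) σ-ext f
      where open _⊑_ r⊑q

  descending-avoids : ∀ {p i lo′ hi′} →
    (∀ {x} → ⟨ lo′ , hi′ ⟩ x → ⟨ lo p , hi p ⟩ x) → Infinite ⟨ lo′ , hi′ ⟩ →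
    Inessential (DescendingReach p lo′ hi′ i) → ∃[ q ] (q ⊑ p × Desc.Handles i q)
  descending-avoids {p} {i} {lo′} {hi′} sub inf avoid
    with q , q⊑p , refl , refl , refl , refl ← narrow p _ _ sub inf =
    q , q⊑p , inj₂ (Inessential-⊆ reach avoid)
    where
    reach : ∀ {R S} → ∃[ r ] (r ⊑ q × Forces ⟦ i ⟧ᴼ (τ r) Z R S) →
            DescendingReach p lo′ hi′ i R S
    reach {R} {S} (r , r⊑q , f) = τ′ , τ′-between ,
      subst (AllPairs _) τ-ext (descending r) ,
      Infinite-⊆ (λ b → between-++ σ′ [] (shrink b)) (infinite r) ,
      subst (λ ρ → Forces ⟦ i ⟧ᴼ ρ Z R S) τ-ext f
      where open _⊑_ r⊑q

  ascending-meets : ∀ {p i} σ′ → All ⟨ lo p , hi p ⟩ σ′ →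
    AllPairs (flip _≺_) (σ′ ++ σ p) → Infinite ⟨ σ′ ++ lo p , hi p ⟩ →
    Met em A B i (σ′ ++ σ p) Z → ∃[ q ] (q ⊑ p × Asc.Handles i q)
  ascending-meets {p} σ′ btw asc inf met
    with q , q⊑p , refl , _ ← add-σ p σ′ btw asc inf = q , q⊑p , inj₁ met

  descending-meets : ∀ {p i} τ′ → All ⟨ lo p , hi p ⟩ τ′ →
    AllPairs _≺_ (τ′ ++ τ p) → Infinite ⟨ lo p , τ′ ++ hi p ⟩ →
    Met em A B i (τ′ ++ τ p) Z → ∃[ q ] (q ⊑ p × Desc.Handles i q)
  descending-meets {p} τ′ btw desc inf met
    with q , q⊑p , refl , _ ← add-τ p τ′ btw desc inf = q , q⊑p , inj₁ met

  -- Each x lies above all of σ′ or below all of τ′.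
  separated-side : ∀ {p σ′ τ′} → Extension _≺_ (σ p) (τ p) (lo p) (hi p) σ′ τ′ →
    Infinite ⟨ σ′ ++ lo p , hi p ⟩ ⊎ Infinite ⟨ lo p , τ′ ++ hi p ⟩
  separated-side {p} {σ′} {τ′} ext = Infinite-∪ em side (infinite p)
    where
    open Extension ext
    side : ∀ {x} → ⟨ lo p , hi p ⟩ x →
           ⟨ σ′ ++ lo p , hi p ⟩ x ⊎ ⟨ lo p , τ′ ++ hi p ⟩ x
    side {x} (a , b) with All.all? (λ s → em {s ≺ x}) σ′
    ... | yes σ′≺x = inj₁ (All.++⁺ σ′≺x a , b)
    ... | no ¬σ′≺x
      with s , s∈ , s⊀x ← find (All.¬All⇒Any¬ (λ s → em {s ≺ x}) σ′ ¬σ′≺x)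
      = inj₂ (a , All.++⁺ (All.map below (All.lookup separated s∈)) b)
      where
      below : ∀ {t} → s ≺ t → x ≺ t
      below {t} s≺t with total s x
      ... | inj₁ s≺x = ⊥-elim (s⊀x s≺x)
      ... | inj₂ (inj₁ refl) = s≺t
      ... | inj₂ (inj₂ x≺s) = transitive x s t x≺s s≺t

  -- An inessential reach lets its side avoid the requirement. If both reaches are essential, a
  -- joint extension meets both requirements, and `separated-side` tells which of them may be kept.
  two-sided : ∀ p i j → (∃[ q ] (q ⊑ p × Asc.Handles i q))
                      ⊎ (∃[ q ] (q ⊑ p × Desc.Handles j q))
  two-sided p i j = split (em {∃[ z ] Split p z})
    where
    Outcome = (∃[ q ] (q ⊑ p × Asc.Handles i q)) ⊎ (∃[ q ] (q ⊑ p × Desc.Handles j q))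

    joint : ∃[ σ′ ] ∃[ τ′ ] (Extension _≺_ (σ p) (τ p) (lo p) (hi p) σ′ τ′
              × Met em A B i (σ′ ++ σ p) Z × Met em A B j (τ′ ++ τ p) Z) → Outcome
    joint (σ′ , τ′ , ext , met , met′) =
      Sum.map (λ inf → ascending-meets σ′ σ′-between σ′-ascending inf met)
              (λ inf → descending-meets τ′ τ′-between τ′-descending inf met′)
              (separated-side {p} ext)
      where open Extension ext

    try : ∀ lo₁ hi₁ lo₂ hi₂ →
      (∀ {x} → ⟨ lo₁ , hi₁ ⟩ x → ⟨ lo p , hi p ⟩ x) →
      (∀ {x} → ⟨ lo₂ , hi₂ ⟩ x → ⟨ lo p , hi p ⟩ x) →
      Infinite ⟨ lo₁ , hi₁ ⟩ → Infinite ⟨ lo₂ , hi₂ ⟩ →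
      (∀ {s t} → ⟨ lo₁ , hi₁ ⟩ s → Infinite ⟨ s ∷ lo₁ , hi₁ ⟩ →
                 ⟨ lo₂ , hi₂ ⟩ t → Infinite ⟨ lo₂ , t ∷ hi₂ ⟩ → s ≺ t) → Outcome
    try lo₁ hi₁ lo₂ hi₂ sub₁ sub₂ inf₁ inf₂ sep
      with essential? em (AscendingReach p lo₁ hi₁ i)
         | essential? em (DescendingReach p lo₂ hi₂ j)
    ... | inj₂ avoid | _ = inj₁ (ascending-avoids sub₁ inf₁ avoid)
    ... | inj₁ _ | inj₂ avoid = inj₂ (descending-avoids sub₂ inf₂ avoid)
    ... | inj₁ ess | inj₁ ess′ =
      joint (joint-extension p i j lo₁ hi₁ lo₂ hi₂ sub₁ sub₂ sep ess ess′)

    split : Dec (∃[ z ] Split p z) → Outcome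
    -- A splitting point allots the part below it to `σ` and the part above it to `τ`.
    split (yes (z , _ , inf< , inf>)) =
      try (lo p) (z ∷ hi p) (z ∷ lo p) (hi p)
        (between-++ [] (z ∷ [])) (between-++ (z ∷ []) []) inf< inf>
        λ { (_ , s≺z ∷ _) _ (z≺t ∷ _ , _) _ → transitive _ z _ s≺z z≺t }
    split (no ¬split) =
      try (lo p) (hi p) (lo p) (hi p) (λ b → b) (λ b → b) (infinite p) (infinite p) sep
      where
      -- Without a splitting point the order separates the candidates by itself: if `t` were equal
      -- to or below `s`, the infinitely many points below `t` would lie below `s`, and `s` would
      -- split.
      sep : ∀ {s t} → ⟨ lo p , hi p ⟩ s → Infinite ⟨ s ∷ lo p , hi p ⟩ →
            ⟨ lo p , hi p ⟩ t → Infinite ⟨ lo p , t ∷ hi p ⟩ → s ≺ t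
      sep {s} {t} bs infs bt inft with total s t
      ... | inj₁ s≺t = s≺t
      ... | inj₂ (inj₁ refl) = ⊥-elim (¬split (s , bs , inft , infs))
      ... | inj₂ (inj₂ t≺s) = ⊥-elim (¬split (s , bs ,
        Infinite-⊆ (λ { (a , x≺t ∷ b) → a , transitive _ t s x≺t t≺s ∷ b }) inft , infs))

  -- When no element can be put on σ, the descending side succeeds: top is then
  -- only ever met by the empty extension of σ.
  Stuck-σ Stuck-τ : Cond → Set
  Stuck-σ p = ∀ {z} → ⟨ lo p , hi p ⟩ z → ¬ Infinite ⟨ z ∷ lo p , hi p ⟩
  Stuck-τ p = ∀ {z} → ⟨ lo p , hi p ⟩ z → ¬ Infinite ⟨ lo p , z ∷ hi p ⟩

  Stuck-σ-⊑ : ∀ {p q} → q ⊑ p → Stuck-σ p → Stuck-σ q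
  Stuck-σ-⊑ q⊑p stuck b inf = stuck (wider b)
    (Infinite-⊆ (λ { (z≺x ∷ a , b) → let a′ , b′ = wider (a , b) in z≺x ∷ a′ , b′ }) inf)
    where
    open _⊑_ q⊑p
    wider = λ {x} b → between-++ σ′ τ′ {x = x} (shrink b)

  Stuck-τ-⊑ : ∀ {p q} → q ⊑ p → Stuck-τ p → Stuck-τ q
  Stuck-τ-⊑ q⊑p stuck b inf = stuck (wider b)
    (Infinite-⊆ (λ { (a , x≺z ∷ b) → let a′ , b′ = wider (a , b) in a′ , x≺z ∷ b′ }) inf)
    where
    open _⊑_ q⊑p
    wider = λ {x} b → between-++ σ′ τ′ {x = x} (shrink b)

  -- No point has infinitely many above it, so each has infinitely many below it. The newest entry
  -- of `τ′` is its least, and points below it are below all of `τ′`.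
  room-below : ∀ p τ′ → Stuck-σ p → All ⟨ lo p , hi p ⟩ τ′ →
               AllPairs _≺_ (τ′ ++ τ p) → Infinite ⟨ lo p , τ′ ++ hi p ⟩
  room-below p [] _ _ _ = infinite p
  room-below p (t ∷ τ′) stuck (bt ∷ _) (t≺ ∷ _) with infinite-side p t
  ... | inj₂ inf = ⊥-elim (stuck bt inf)
  ... | inj₁ inf = Infinite-⊆ (λ { {x} (a , x≺t ∷ b) → a , x≺t ∷
    All.++⁺ (All.map (λ {r} → transitive x t r x≺t) (All.++⁻ˡ τ′ t≺)) b }) inf

  room-above : ∀ p σ′ → Stuck-τ p → All ⟨ lo p , hi p ⟩ σ′ →
               AllPairs (flip _≺_) (σ′ ++ σ p) → Infinite ⟨ σ′ ++ lo p , hi p ⟩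
  room-above p [] _ _ _ = infinite p
  room-above p (s ∷ σ′) stuck (bs ∷ _) (≺s ∷ _) with infinite-side p s
  ... | inj₁ inf = ⊥-elim (stuck bs inf)
  ... | inj₂ inf = Infinite-⊆ (λ { {x} (s≺x ∷ a , b) → s≺x ∷
    All.++⁺ (All.map (λ {r} r≺s → transitive r s x r≺s s≺x) (All.++⁻ˡ σ′ ≺s)) a , b })
    inf

  -- With `top` on the ascending side the joint extension serves `j` alone, its separation
  -- hypothesis being vacuous; `room-below` then recovers the infinite interval.
  stuck-σ-descends : ∀ p j → Stuck-σ p → ∃[ q ] (q ⊑ p × Desc.Handles j q)
  stuck-σ-descends p j stuck with essential? em (DescendingReach p (lo p) (hi p) j)
  ... | inj₂ avoid = descending-avoids (λ b → b) (infinite p) avoid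
  ... | inj₁ ess =
    let σ′ , τ′ , ext , _ , met =
          joint-extension p top j (lo p) (hi p) (lo p) (hi p)
            (λ b → b) (λ b → b) (λ b inf _ _ → ⊥-elim (stuck b inf)) trivial ess
        open Extension ext
    in descending-meets τ′ τ′-between τ′-descending
         (room-below p τ′ stuck τ′-between τ′-descending) met
    where
    trivial : Essential (AscendingReach p (lo p) (hi p) top)
    trivial x = [] , [] , λ y → [] , [] , [] , [] , ascending p , infinite p ,
      0 , λ _ _ _ _ → tt

  stuck-τ-ascends : ∀ p i → Stuck-τ p → ∃[ q ] (q ⊑ p × Asc.Handles i q)
  stuck-τ-ascends p i stuck with essential? em (AscendingReach p (lo p) (hi p) i)
  ... | inj₂ avoid = ascending-avoids (λ b → b) (infinite p) avoid
  ... | inj₁ ess =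
    let σ′ , τ′ , ext , met , _ =
          joint-extension p i top (lo p) (hi p) (lo p) (hi p)
            (λ b → b) (λ b → b) (λ _ _ b inf → ⊥-elim (stuck b inf)) ess trivial
        open Extension ext
    in ascending-meets σ′ σ′-between σ′-ascending
         (room-above p σ′ stuck σ′-between σ′-ascending) met
    where
    trivial : Essential (DescendingReach p (lo p) (hi p) top)
    trivial x = [] , [] , λ y → [] , [] , [] , [] , descending p , infinite p ,
      0 , λ _ _ _ _ → tt

  grow-σ : ∀ p {z} → ⟨ lo p , hi p ⟩ z → Infinite ⟨ z ∷ lo p , hi p ⟩ →
           ∃[ q ] (q ⊑ p × length (σ p) < length (σ q))
  grow-σ p {z} b inf
    with q , q⊑p , refl , _ ← add-σ p (z ∷ []) (b ∷ []) (above-σ p b ∷ ascending p) inf =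
    q , q⊑p , ≤-refl

  grow-τ : ∀ p {z} → ⟨ lo p , hi p ⟩ z → Infinite ⟨ lo p , z ∷ hi p ⟩ →
           ∃[ q ] (q ⊑ p × length (τ p) < length (τ q))
  grow-τ p {z} b inf
    with q , q⊑p , refl , _ ← add-τ p (z ∷ []) (b ∷ []) (below-τ p b ∷ descending p) inf =
    q , q⊑p , ≤-refl

  Solution : Set
  Solution = ∃[ f ] (DH (f ∷ Z) × ((∀ k l → k < l → f k ≺ f l)
                                   ⊎ (∀ k l → k < l → f l ≺ f k)))

  ascend : ∀ p₀ → (∀ p → p ⊑ p₀ → ∀ i → Asc.Progress i p) → Solution
  ascend p₀ progress with f , dh′ , app ← Asc.generic p₀ progress =
    f , dh′ , inj₁ λ k l k<l → let p , ext , l<n = app l in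
      subst₂ _≺_ (sym (ext k (<-trans k<l l<n))) (sym (ext l l<n))
        (at-AllPairs {R = _≺_} (ascending p) k<l l<n)

  descend : ∀ p₀ → (∀ p → p ⊑ p₀ → ∀ i → Desc.Progress i p) → Solution
  descend p₀ progress with f , dh′ , app ← Desc.generic p₀ progress =
    f , dh′ , inj₂ λ k l k<l → let p , ext , l<n = app l in
      subst₂ _≺_ (sym (ext l l<n)) (sym (ext k (<-trans k<l l<n)))
        (at-AllPairs {R = flip _≺_} (descending p) k<l l<n)

  asc-progress : ∀ {p i} → ¬ Stuck-σ p →
    (∀ q → q ⊑ p → ∃[ r ] (r ⊑ q × Asc.Handles i r)) → Asc.Progress i p
  asc-progress {p} {i} ¬stuck handle
    with z , b , inf ← dne em {∃[ z ] (⟨ lo p , hi p ⟩ z × Infinite ⟨ z ∷ lo p , hi p ⟩)}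
                         (λ ¬z → ¬stuck λ {z} b inf → ¬z (z , b , inf))
    with q , q⊑p , p<q ← grow-σ p b inf
    with r , r⊑q , h ← handle q q⊑p =
    r , ⊑-trans r⊑q q⊑p , <-≤-trans p<q (Asc.length-⊑ r⊑q) , h

  desc-progress : ∀ {p i} → ¬ Stuck-τ p →
    (∀ q → q ⊑ p → ∃[ r ] (r ⊑ q × Desc.Handles i r)) → Desc.Progress i p
  desc-progress {p} {i} ¬stuck handle
    with z , b , inf ← dne em {∃[ z ] (⟨ lo p , hi p ⟩ z × Infinite ⟨ lo p , z ∷ hi p ⟩)}
                         (λ ¬z → ¬stuck λ {z} b inf → ¬z (z , b , inf))
    with q , q⊑p , p<q ← grow-τ p b inf
    with r , r⊑q , h ← handle q q⊑p =
    r , ⊑-trans r⊑q q⊑p , <-≤-trans p<q (Desc.length-⊑ r⊑q) , h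

  element : ∀ p → ∃[ z ] ⟨ lo p , hi p ⟩ z
  element p = let z , _ , b = infinite p 0 in z , b

  not-both-stuck : ∀ p → Stuck-σ p → ¬ Stuck-τ p
  not-both-stuck p stuckσ stuckτ with z , b ← element p with infinite-side p z
  ... | inj₁ inf = stuckτ b inf
  ... | inj₂ inf = stuckσ b inf

  whole : Cond
  whole = record
    { σ = [] ; τ = [] ; lo = [] ; hi = [] ; ascending = [] ; descending = []
    ; above-σ = λ _ → [] ; below-τ = λ _ → []
    ; infinite = λ m → suc m , ≤-refl , [] , [] }

  -- Below a stuck condition the other side is built. If there is none, either every `i` can always
  -- be handled ascending, or some `i` fails below some `p`; then `two-sided` with this `i` handles
  -- every `j` on the descending side below `p`.
  solve : Solution
  solve with em {Σ Cond Stuck-σ} | em {Σ Cond Stuck-τ}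
  ... | yes (p , stuck) | _ = descend p λ q q⊑p j →
    desc-progress (not-both-stuck q (Stuck-σ-⊑ q⊑p stuck)) λ r r⊑q →
      stuck-σ-descends r j (Stuck-σ-⊑ (⊑-trans r⊑q q⊑p) stuck)
  ... | no _ | yes (p , stuck) = ascend p λ q q⊑p i →
    asc-progress (λ stuck′ → not-both-stuck q stuck′ (Stuck-τ-⊑ q⊑p stuck)) λ r r⊑q →
      stuck-τ-ascends r i (Stuck-τ-⊑ (⊑-trans r⊑q q⊑p) stuck)
  ... | no ¬stuckσ | no ¬stuckτ
    with em {∃[ p ] ∃[ i ] ¬ (∃[ q ] (q ⊑ p × Asc.Handles i q))}
  ... | no ¬fails = ascend whole λ p _ i → asc-progress (λ s → ¬stuckσ (p , s))
    λ q _ → dne em λ ¬h → ¬fails (q , i , ¬h)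
  ... | yes (p , i , fails) = descend p λ q q⊑p j →
    desc-progress (λ s → ¬stuckτ (q , s)) λ r r⊑q → handle r (⊑-trans r⊑q q⊑p) j
    where
    handle : ∀ r → r ⊑ p → ∀ j → ∃[ r′ ] (r′ ⊑ r × Desc.Handles j r′)
    handle r r⊑p j with two-sided r i j
    ... | inj₁ (r′ , r′⊑r , h) = ⊥-elim (fails (r′ , ⊑-trans r′⊑r r⊑p , h))
    ... | inj₂ h = h

-- A generic stable poset

bounded : ∀ R → ∃[ N ] All (_< N) R
bounded [] = 0 , []
bounded (r ∷ R) with N , R<N ← bounded R =
  suc r ⊔ N , m≤m⊔n (suc r) N ∷ All.map (λ x<N → ≤-trans x<N (m≤n⊔m (suc r) N)) R<N

-- Containment in the usual order yields antisymmetry, and it reduces incomparability with a later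
-- element to not being below it.
record NatPoset (r : ℕ → ℕ → Bool) : Set where
  field
    ⇒≤         : ∀ {x y} → T (r x y) → x ≤ y
    reflexive  : ∀ x → T (r x x)
    transitive : ∀ {x y z} → T (r x y) → T (r y z) → T (r x z)

module GenericPoset (em : ExcludedMiddle 0ℓ) where
  open Semantics em

  relOracle : (ℕ → ℕ → Bool) → Oracle
  relOracle r = χ (relSet (λ x y → T (r x y))) ∷ []

  Agree : ℕ → (r r′ : ℕ → ℕ → Bool) → Set
  Agree N r r′ = ∀ x y → x < N → y < N → r x y ≡ r′ x y

  relOracle-∼ : ∀ {N r r′} → Agree N r r′ → relOracle r ∼[ N ] relOracle r′
  relOracle-∼ {r = r} {r′} agree =
    (λ m m<N → cong (λ b → if b then 1 else 0)
      (relSet-≈ (λ x y x<N y<N → subst T (agree x y x<N y<N) ,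
                                 subst T (sym (agree x y x<N y<N))) m m<N)) ∷ []

  -- A condition decides the poset below n, and promises that x < n is below
  -- all, or incomparable to all, elements from n on, according to label x.
  record Cond : Set where
    field
      rel      : ℕ → ℕ → Bool
      label    : ℕ → Bool
      n        : ℕ
      natPoset : NatPoset rel
      promise  : ∀ x y → x < n → n ≤ y → rel x y ≡ label x
  open Cond

  record Compatibleᶜ (p : Cond) (r : ℕ → ℕ → Bool) : Set where
    field
      agree : Agree (n p) r (rel p)
      keep  : ∀ x y → x < n p → n p ≤ y → r x y ≡ label p x

  record _⊑_ (q p : Cond) : Set where
    field
      n-≤        : n p ≤ n q
      labels     : ∀ x → x < n p → label q x ≡ label p x
      compatible : Compatibleᶜ p (rel q)

  ⊑-refl : ∀ {p} → p ⊑ p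
  ⊑-refl {p} = record
    { n-≤ = ≤-refl ; labels = λ _ _ → refl
    ; compatible = record { agree = λ _ _ _ _ → refl ; keep = promise p } }

  ⊑-trans : ∀ {p q r} → r ⊑ q → q ⊑ p → r ⊑ p
  ⊑-trans {p} {q} {r} r⊑q q⊑p = record
    { n-≤ = ≤-trans Q.n-≤ R.n-≤
    ; labels = λ x x<n → trans (R.labels x (<-≤-trans x<n Q.n-≤)) (Q.labels x x<n)
    ; compatible = record
      { agree = λ x y x<n y<n →
          trans (R.agree x y (<-≤-trans x<n Q.n-≤) (<-≤-trans y<n Q.n-≤))
                (Q.agree x y x<n y<n)
      ; keep = keep′ } }
    where
    module Q where
      open _⊑_ q⊑p public
      open Compatibleᶜ compatible public
    module R where
      open _⊑_ r⊑q public
      open Compatibleᶜ compatible public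
    keep′ : ∀ x y → x < n p → n p ≤ y → rel r x y ≡ label p x
    keep′ x y x<n n≤y with <-≤-connex y (n q)
    ... | inj₁ y<nq = trans (R.agree x y (<-≤-trans x<n Q.n-≤) y<nq) (Q.keep x y x<n n≤y)
    ... | inj₂ nq≤y = trans (R.keep x y (<-≤-trans x<n Q.n-≤) nq≤y) (Q.labels x x<n)

  -- Freeze r below N, let the elements below some member of R promise to be
  -- below everything, and all other new elements to be incomparable.
  module Relabel (p : Cond) (r : ℕ → ℕ → Bool) (poset : NatPoset r)
                 (compat : Compatibleᶜ p r) (R : List ℕ) (N : ℕ) (n≤N : n p ≤ N)
                 where
    open NatPoset poset
    open Compatibleᶜ compat

    Labelled : ℕ → Set
    Labelled x = x < n p × T (label p x) ⊎ n p ≤ x × Any (λ y → T (r x y)) R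

    Below : ℕ → ℕ → Set
    Below x y = y < N × T (r x y) ⊎ N ≤ y × (x < N × Labelled x ⊎ x ≡ y)

    -- Downward closure of the labels is what makes `Below` transitive across the threshold `N`.
    Labelled-down : ∀ {x y} → T (r x y) → Labelled y → Labelled x
    Labelled-down {x} {y} xy (inj₁ (y<n , ℓy)) =
      -- The element `n p` is a sample of those that the promises of `p` concern: an old element is
      -- below it exactly if it is labelled.
      inj₁ (x<n , subst T (keep x (n p) x<n ≤-refl)
        (transitive xy (subst T (sym (keep y (n p) y<n ≤-refl)) ℓy)))
      where x<n = ≤-<-trans (⇒≤ xy) y<n
    Labelled-down {x} {y} xy (inj₂ (n≤y , y∈)) with <-≤-connex x (n p)
    ... | inj₁ x<n = inj₁ (x<n , subst T (keep x y x<n n≤y) xy)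
    ... | inj₂ n≤x = inj₂ (n≤x , Any.map (transitive xy) y∈)

    Below-≤ : ∀ {x y} → Below x y → x ≤ y
    Below-≤ (inj₁ (_ , xy)) = ⇒≤ xy
    Below-≤ (inj₂ (N≤y , inj₁ (x<N , _))) = ≤-trans (<⇒≤ x<N) N≤y
    Below-≤ (inj₂ (_ , inj₂ refl)) = ≤-refl

    Below-trans : ∀ {x y z} → Below x y → Below y z → Below x z
    Below-trans b (inj₁ (z<N , yz)) with b
    ... | inj₁ (_ , xy) = inj₁ (z<N , transitive xy yz)
    ... | inj₂ (N≤y , _) = ⊥-elim (<-irrefl refl (<-≤-trans z<N (≤-trans N≤y (⇒≤ yz))))
    Below-trans b (inj₂ (N≤z , inj₂ refl)) = b
    Below-trans b (inj₂ (N≤z , inj₁ (y<N , ℓy))) with b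
    ... | inj₁ (_ , xy) =
      inj₂ (N≤z , inj₁ (≤-<-trans (⇒≤ xy) y<N , Labelled-down xy ℓy))
    ... | inj₂ (N≤y , _) = ⊥-elim (<-irrefl refl (<-≤-trans y<N N≤y))

    rel′ : ℕ → ℕ → Bool
    rel′ x y = decide (Below x y)

    label′ : ℕ → Bool
    label′ x = decide (Labelled x)

    label′-old : ∀ x → x < n p → label′ x ≡ label p x
    label′-old x x<n = T-ext (λ t → old (decide⁻ t)) (λ ℓx → decide⁺ (inj₁ (x<n , ℓx)))
      where
      old : Labelled x → T (label p x)
      old (inj₁ (_ , ℓx)) = ℓx
      old (inj₂ (n≤x , _)) = ⊥-elim (<-irrefl refl (<-≤-trans x<n n≤x))

    rel′-old : Agree N rel′ r
    rel′-old x y x<N y<N = T-ext (λ t → old (decide⁻ t)) (λ xy → decide⁺ (inj₁ (y<N , xy)))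
      where
      old : Below x y → T (r x y)
      old (inj₁ (_ , xy)) = xy
      old (inj₂ (N≤y , _)) = ⊥-elim (<-irrefl refl (<-≤-trans y<N N≤y))

    relabelled : Cond
    relabelled = record
      { rel = rel′ ; label = label′ ; n = N
      ; natPoset = record
        { ⇒≤ = λ t → Below-≤ (decide⁻ t)
        ; reflexive = λ x → decide⁺ (below-refl x)
        ; transitive = λ s t → decide⁺ (Below-trans (decide⁻ s) (decide⁻ t)) }
      ; promise = λ x y x<N N≤y → T-ext
          (λ t → decide⁺ (label-of x<N N≤y (decide⁻ t)))
          (λ t → decide⁺ (inj₂ (N≤y , inj₁ (x<N , decide⁻ t)))) }
      where
      below-refl : ∀ x → Below x x
      below-refl x with <-≤-connex x N
      ... | inj₁ x<N = inj₁ (x<N , reflexive x)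
      ... | inj₂ N≤x = inj₂ (N≤x , inj₂ refl)
      label-of : ∀ {x y} → x < N → N ≤ y → Below x y → Labelled x
      label-of x<N N≤y (inj₁ (y<N , _)) = ⊥-elim (<-irrefl refl (<-≤-trans y<N N≤y))
      label-of x<N N≤y (inj₂ (_ , inj₁ (_ , ℓx))) = ℓx
      label-of x<N N≤y (inj₂ (_ , inj₂ refl)) = ⊥-elim (<-irrefl refl (<-≤-trans x<N N≤y))

    relabelled-⊑ : relabelled ⊑ p
    relabelled-⊑ = record
      { n-≤ = n≤N ; labels = label′-old
      ; compatible = record
        { agree = λ x y x<n y<n →
            trans (rel′-old x y (<-≤-trans x<n n≤N) (<-≤-trans y<n n≤N))
                  (agree x y x<n y<n)
        ; keep = keep′ } }
      where
      keep′ : ∀ x y → x < n p → n p ≤ y → rel′ x y ≡ label p x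
      keep′ x y x<n n≤y with <-≤-connex y N
      ... | inj₁ y<N = trans (rel′-old x y (<-≤-trans x<n n≤N) y<N) (keep x y x<n n≤y)
      ... | inj₂ N≤y = trans (promise relabelled x y (<-≤-trans x<n n≤N) N≤y)
                             (label′-old x x<n)

  Witness : Cond → Op → Set
  Witness p i = ∃[ r ] ∃[ R ] ∃[ S ]
    (NatPoset r × Compatibleᶜ p r × All (n p ≤_) R × All (n p ≤_) S ×
     All (λ x → All (x <_) S) R × Holds i (relOracle r) R S)

  MetBy : Cond → Op → Set
  MetBy q i = ∃[ R ] ∃[ S ]
    (All (λ x → x < n q × T (label q x)) R × All (λ x → x < n q × ¬ T (label q x)) S ×
     ∀ r → Agree (n q) (rel q) r → Holds i (relOracle r) R S)

  Step : Cond → Op → Set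
  Step p i = ∃[ q ] (q ⊑ p × n p < n q × (MetBy q i ⊎ ¬ Witness p i))

  -- Relabelling gives all of `R` the label A. Elements of `S` come after those of `R`, hence are
  -- below none of them, and stay unlabelled.
  meet : ∀ p i → Witness p i → Step p i
  meet p i (r , R , S , poset , compat , n≤R , n≤S , R<S , k , holds)
    with N₁ , R<N ← bounded R | N₂ , S<N ← bounded S =
    relabelled , relabelled-⊑ , n<N , inj₁
      (R , S , All.tabulate inR , All.tabulate inS ,
       λ r′ agree → N , λ Z′ e → holds Z′ (∼-trans
         (relOracle-∼ λ x y x<k y<k →
            trans (sym (rel′-old x y (<-≤-trans x<k k≤N) (<-≤-trans y<k k≤N)))
                  (agree x y (<-≤-trans x<k k≤N) (<-≤-trans y<k k≤N)))
         (∼-weaken k≤N e)))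
    where
    -- Beyond `n p` for progress, beyond `k` to preserve `holds`, and beyond all elements of `R` and
    -- `S` so that their labels are fixed.
    N = suc (n p) ⊔ (k ⊔ (N₁ ⊔ N₂))
    n<N : n p < N
    n<N = m≤m⊔n (suc (n p)) (k ⊔ (N₁ ⊔ N₂))
    k≤N : k ≤ N
    k≤N = ≤-trans (m≤m⊔n k _) (m≤n⊔m (suc (n p)) _)
    N₁≤N : N₁ ≤ N
    N₁≤N = ≤-trans (m≤m⊔n N₁ N₂) (≤-trans (m≤n⊔m k _) (m≤n⊔m (suc (n p)) _))
    N₂≤N : N₂ ≤ N
    N₂≤N = ≤-trans (m≤n⊔m N₁ N₂) (≤-trans (m≤n⊔m k _) (m≤n⊔m (suc (n p)) _))
    open Relabel p r poset compat R N (<⇒≤ n<N)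
    open NatPoset poset
    inR : ∀ {x} → x ∈ R → x < N × T (label′ x)
    inR {x} x∈ = <-≤-trans (All.lookup R<N x∈) N₁≤N ,
      decide⁺ (inj₂ (All.lookup n≤R x∈ ,
                     Any.map (λ { refl → reflexive x }) x∈))
    inS : ∀ {x} → x ∈ S → x < N × ¬ T (label′ x)
    inS {x} x∈ = <-≤-trans (All.lookup S<N x∈) N₂≤N , λ t → unlabelled (decide⁻ t)
      where
      unlabelled : ¬ Labelled x
      unlabelled (inj₁ (x<n , _)) = <-irrefl refl (<-≤-trans x<n (All.lookup n≤S x∈))
      unlabelled (inj₂ (_ , any)) with y , y∈ , xy ← find any =
        <-irrefl refl (<-≤-trans (All.lookup (All.lookup R<S y∈) x∈) (⇒≤ xy))

  step : ∀ p i → Step p i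
  step p i with em {Witness p i}
  ... | yes w = meet p i w
  -- With nothing to meet, the condition still grows by one element, which gets label B.
  ... | no ¬w = relabelled , relabelled-⊑ , ≤-refl , inj₂ ¬w
    where open Relabel p (rel p) (natPoset p) (_⊑_.compatible (⊑-refl {p}))
                       [] (suc (n p)) (n≤1+n (n p))

  cond : ℕ → Cond
  cond zero = record
    { rel = λ x y → decide (x ≡ y) ; label = λ _ → true ; n = 0
    ; natPoset = record
      { ⇒≤ = λ t → ≤-reflexive (decide⁻ t)
      ; reflexive = λ _ → decide⁺ refl
      ; transitive = λ s t → decide⁺ (trans (decide⁻ s) (decide⁻ t)) }
    ; promise = λ _ _ () }
  cond (suc s) = proj₁ (step (cond s) (opAt s))

  cond-⊑ : ∀ {s t} → s ≤′ t → cond t ⊑ cond s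
  cond-⊑ ≤′-refl = ⊑-refl
  cond-⊑ (≤′-step {t} s≤t) =
    ⊑-trans (proj₁ (proj₂ (step (cond t) (opAt t)))) (cond-⊑ s≤t)

  n-cond : ∀ s → s ≤ n (cond s)
  n-cond zero = z≤n
  n-cond (suc s) = ≤-<-trans (n-cond s) (proj₁ (proj₂ (proj₂ (step (cond s) (opAt s)))))

  rel-cond : ∀ {s t} → s ≤ t → Agree (n (cond s)) (rel (cond t)) (rel (cond s))
  rel-cond s≤t = Compatibleᶜ.agree (_⊑_.compatible (cond-⊑ (≤⇒≤′ s≤t)))

  label-cond : ∀ {s t} → s ≤ t → ∀ x → x < n (cond s) →
               label (cond t) x ≡ label (cond s) x
  label-cond s≤t = _⊑_.labels (cond-⊑ (≤⇒≤′ s≤t))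

  _≼ᵇ_ : ℕ → ℕ → Bool
  x ≼ᵇ y = rel (cond (suc (x ⊔ y))) x y

  A : ℕ → Set
  A x = T (label (cond (suc x)) x)

  ≼-cond : ∀ s → Agree (n (cond s)) _≼ᵇ_ (rel (cond s))
  ≼-cond s x y x<n y<n with ≤-total s (suc (x ⊔ y))
  ... | inj₁ s≤ = rel-cond s≤ x y x<n y<n
  ... | inj₂ ≤s = sym (rel-cond ≤s x y
    (≤-trans (s≤s (m≤m⊔n x y)) (n-cond (suc (x ⊔ y))))
    (≤-trans (s≤s (m≤n⊔m x y)) (n-cond (suc (x ⊔ y)))))

  ≼-label : ∀ s x y → x < n (cond s) → n (cond s) ≤ y → x ≼ᵇ y ≡ label (cond s) x
  ≼-label s x y x<n n≤y = trans
    (≼-cond t x y (<-≤-trans x<n (_⊑_.n-≤ t⊑s)) (≤-trans (m≤n⊔m s (suc y)) (n-cond t)))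
    (Compatibleᶜ.keep (_⊑_.compatible t⊑s) x y x<n n≤y)
    where
    t = s ⊔ suc y
    t⊑s = cond-⊑ (≤⇒≤′ (m≤m⊔n s (suc y)))

  A-label : ∀ s x → x < n (cond s) → label (cond (suc x)) x ≡ label (cond s) x
  A-label s x x<n with ≤-total s (suc x)
  ... | inj₁ s≤ = label-cond s≤ x x<n
  ... | inj₂ ≤s = sym (label-cond ≤s x (n-cond (suc x)))

  ≼-natPoset : NatPoset _≼ᵇ_
  ≼-natPoset = record
    { ⇒≤ = λ {x} {y} t → NatPoset.⇒≤ (natPoset (cond (suc (x ⊔ y)))) t
    ; reflexive = λ x → NatPoset.reflexive (natPoset (cond (suc (x ⊔ x)))) x
    ; transitive = λ {x} {y} {z} xy yz →
        let s = suc (x ⊔ (y ⊔ z))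
            x<n = ≤-trans (s≤s (m≤m⊔n x _)) (n-cond s)
            y<n = ≤-trans (s≤s (≤-trans (m≤m⊔n y z) (m≤n⊔m x _))) (n-cond s)
            z<n = ≤-trans (s≤s (≤-trans (m≤n⊔m y z) (m≤n⊔m x _))) (n-cond s)
        in subst T (sym (≼-cond s x z x<n z<n))
             (NatPoset.transitive (natPoset (cond s))
               (subst T (≼-cond s x y x<n y<n) xy) (subst T (≼-cond s y z y<n z<n) yz)) }

  ≼-compatible : ∀ s → Compatibleᶜ (cond s) _≼ᵇ_
  ≼-compatible s = record { agree = ≼-cond s ; keep = ≼-label s }

  ≼-stable : ∀ x → ∃[ b ] (x ≤ b × (A x → ∀ y → b < y → T (x ≼ᵇ y))
                                × (¬ A x → ∀ y → b < y → ¬ T (x ≼ᵇ y)))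
  ≼-stable x = n (cond (suc x)) , <⇒≤ (n-cond (suc x)) ,
    (λ ax y b<y → subst T (sym (≼-label (suc x) x y (n-cond (suc x)) (<⇒≤ b<y))) ax) ,
    (λ ¬ax y b<y t → ¬ax (subst T (≼-label (suc x) x y (n-cond (suc x)) (<⇒≤ b<y)) t))

  ≼-hyperimmune : DependentlyHyperimmune A (λ x → ¬ A x) (relOracle _≼ᵇ_)
  ≼-hyperimmune i ess with s , refl ← opAt-onto i =
    decided (proj₂ (proj₂ (proj₂ (step p (opAt s)))))
    where
    p = cond s
    q = cond (suc s)
    decided : MetBy q (opAt s) ⊎ ¬ Witness p (opAt s) →
      ∃[ R ] ∃[ S ] (All A R × All (λ x → ¬ A x) S × Holds (opAt s) (relOracle _≼ᵇ_) R S)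
    decided (inj₁ (R , S , aR , bS , h)) = R , S ,
      All.map (λ { {x} (x<n , t) → subst T (sym (A-label (suc s) x x<n)) t }) aR ,
      All.map (λ { {x} (x<n , ¬t) a → ¬t (subst T (A-label (suc s) x x<n) a) }) bS ,
      h _≼ᵇ_ (λ x y x<n y<n → sym (≼-cond (suc s) x y x<n y<n))
    -- The finished poset is compatible with stage `s`. Choosing `R` beyond `n p`, and then `S`
    -- beyond `n p` and all of `R`, would turn it into a witness.
    decided (inj₂ ¬w) with R , n<R , ess-R ← ess (n p)
      with N , R<N ← bounded R
      with S , m<S , holds ← ess-R (n p ⊔ N) = ⊥-elim (¬w
        (_≼ᵇ_ , R , S , ≼-natPoset , ≼-compatible s , All.map <⇒≤ n<R ,
         All.map (λ m<x → ≤-trans (m≤m⊔n (n p) N) (<⇒≤ m<x)) m<S ,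
         All.map (λ x<N → All.map (λ m<y → <-trans x<N (≤-<-trans (m≤n⊔m (n p) N) m<y)) m<S) R<N ,
         holds))

-- Reductions

χ-injective : ∀ (X Y : Subset) m → χ X m ≡ χ Y m → X m ≡ Y m
χ-injective X Y m e with X m | Y m
... | true | true = refl
... | false | false = refl

T⇒χ≡1 : ∀ (X : Subset) m → T (X m) → χ X m ≡ 1
T⇒χ≡1 X m t with X m
... | true = refl

χ≡1⇒T : ∀ (X : Subset) m → 1 ≡ χ X m → T (X m)
χ≡1⇒T X m e with X m
... | true = tt

¬T⇒χ≡0 : ∀ (X : Subset) m → ¬ T (X m) → χ X m ≡ 0
¬T⇒χ≡0 X m ¬t with X m
... | true = ⊥-elim (¬t tt)
... | false = refl

⊕-even : ∀ X Y n → (X ⊕ Y) (n * 2) ≡ X n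
⊕-even X Y n = cong₂ (λ r q → if r ≡ᵇ 0 then X q else Y q) (m*n%n≡0 n 2) (m*n/n≡m n 2)

⊕-odd : ∀ X Y n → (X ⊕ Y) (suc (n * 2)) ≡ Y n
⊕-odd X Y n = cong₂ (λ r q → if r ≡ᵇ 0 then X q else Y q) ([m+kn]%n≡m%n 1 n 2)
  (trans (+-distrib-/-∣ʳ 1 {d = 2} (n∣m*n n)) (m*n/n≡m n 2))

columnIndex-bounded : ∀ m k → ∃[ K ] (∀ (i : Fin m) n → n < k → columnIndex i n < K)
columnIndex-bounded zero k = 0 , λ ()
columnIndex-bounded (suc m) k with K , h ← columnIndex-bounded m k =
  k * 2 ⊔ suc (K * 2) , λ where
    zero n n<k → <-≤-trans (*-monoˡ-< 2 n<k) (m≤m⊔n (k * 2) _)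
    (suc i) n n<k → <-≤-trans (s≤s (*-monoˡ-< 2 (h i n n<k))) (m≤n⊔m (k * 2) _)

columns-≈ : ∀ {m} k → ∃[ K ] (∀ {X Y} → X ≈[ K ] Y →
            ∀ (i : Fin m) → columns X i ≈[ k ] columns Y i)
columns-≈ {m} k with K , h ← columnIndex-bounded m k =
  K , λ X≈Y i n n<k → X≈Y (columnIndex i n) (h i n n<k)

-- Values of terms and the use of Σ⁰₀ formulas

⟦⟧-cong : ∀ {n} (t : Term n) {ν ν′ : Vector ℕ n} → (∀ i → ν i ≡ ν′ i) → ⟦ t ⟧ ν ≡ ⟦ t ⟧ ν′
⟦⟧-cong (var i) e = e i
⟦⟧-cong `0 e = refl
⟦⟧-cong `1 e = refl
⟦⟧-cong (s `+ t) e = cong₂ _+_ (⟦⟧-cong s e) (⟦⟧-cong t e)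
⟦⟧-cong (s `* t) e = cong₂ _*_ (⟦⟧-cong s e) (⟦⟧-cong t e)

⟦⟧-sub : ∀ {n n′} (t : Term n) (τ : Fin n → Term n′) ν →
         ⟦ subᵗ τ t ⟧ ν ≡ ⟦ t ⟧ (λ i → ⟦ τ i ⟧ ν)
⟦⟧-sub (var i) τ ν = refl
⟦⟧-sub `0 τ ν = refl
⟦⟧-sub `1 τ ν = refl
⟦⟧-sub (s `+ t) τ ν = cong₂ _+_ (⟦⟧-sub s τ ν) (⟦⟧-sub t τ ν)
⟦⟧-sub (s `* t) τ ν = cong₂ _*_ (⟦⟧-sub s τ ν) (⟦⟧-sub t τ ν)

∷-cong : ∀ {n} {ν ν′ : Vector ℕ n} a → (∀ i → ν i ≡ ν′ i) →
         ∀ i → (a Env.∷ ν) i ≡ (a Env.∷ ν′) i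
∷-cong a e zero = refl
∷-cong a e (suc i) = e i

⟦⟧-wk : ∀ {n} (t : Term n) {ν ν′ : Vector ℕ n} → (∀ i → ν i ≡ ν′ i) →
        ∀ a → ⟦ wkᵗ t ⟧ (a Env.∷ ν′) ≡ ⟦ t ⟧ ν
⟦⟧-wk t {ν′ = ν′} e a = trans (⟦⟧-sub t _ (a Env.∷ ν′)) (sym (⟦⟧-cong t e))

module _ (I I′ : Subset → Set) where

  -- The collections `I` and `I′` may differ, which permits `delta` to evaluate formulas in the
  -- empty one.
  Use : ∀ {m n} → Vector Subset m → Vector ℕ n → Form m n → ℕ → Set
  Use {m} {n} σ ν θ k = ∀ (σ′ : Vector Subset m) (ν′ : Vector ℕ n) →
    (∀ i → σ i ≈[ k ] σ′ i) → (∀ i → ν i ≡ ν′ i) →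
    (Sat I σ ν θ → Sat I′ σ′ ν′ θ) × (Sat I′ σ′ ν′ θ → Sat I σ ν θ)

  Use-mono : ∀ {m n} {σ : Vector Subset m} {ν : Vector ℕ n} θ {k k′} → k ≤ k′ →
             Use σ ν θ k → Use σ ν θ k′
  Use-mono θ k≤k′ u σ′ ν′ σ≈ = u σ′ ν′ (λ i → ≈-weaken k≤k′ (σ≈ i))

  Σ⁰₀-use : ∀ {m n} {θ : Form m n} → Σ⁰₀ θ → ∀ σ ν → ∃[ k ] Use σ ν θ k
  Σ⁰₀-use (eq {s} {t}) σ ν = 0 , λ σ′ ν′ _ e →
    (λ h → trans (sym (⟦⟧-cong s e)) (trans h (⟦⟧-cong t e))) ,
    (λ h → trans (⟦⟧-cong s e) (trans h (sym (⟦⟧-cong t e))))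
  Σ⁰₀-use (lt {s} {t}) σ ν = 0 , λ σ′ ν′ _ e →
    subst₂ _<_ (⟦⟧-cong s e) (⟦⟧-cong t e) ,
    subst₂ _<_ (sym (⟦⟧-cong s e)) (sym (⟦⟧-cong t e))
  Σ⁰₀-use (mem {t} {X}) σ ν = suc (⟦ t ⟧ ν) , λ σ′ ν′ σ≈ e →
    let b = trans (σ≈ X (⟦ t ⟧ ν) ≤-refl) (cong (σ′ X) (⟦⟧-cong t e))
    in subst T b , subst T (sym b)
  Σ⁰₀-use bot σ ν = 0 , λ _ _ _ _ → (λ h → h) , (λ h → h)
  Σ⁰₀-use (and {φ} {ψ} d d′) σ ν with k , u ← Σ⁰₀-use d σ ν | k′ , u′ ← Σ⁰₀-use d′ σ ν =
    k ⊔ k′ , λ σ′ ν′ σ≈ e →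
      let f , g = Use-mono φ (m≤m⊔n k k′) u σ′ ν′ σ≈ e
          f′ , g′ = Use-mono ψ (m≤n⊔m k k′) u′ σ′ ν′ σ≈ e
      in (λ (a , b) → f a , f′ b) , (λ (a , b) → g a , g′ b)
  Σ⁰₀-use (or {φ} {ψ} d d′) σ ν with k , u ← Σ⁰₀-use d σ ν | k′ , u′ ← Σ⁰₀-use d′ σ ν =
    k ⊔ k′ , λ σ′ ν′ σ≈ e →
      let f , g = Use-mono φ (m≤m⊔n k k′) u σ′ ν′ σ≈ e
          f′ , g′ = Use-mono ψ (m≤n⊔m k k′) u′ σ′ ν′ σ≈ e
      in Sum.map f f′ , Sum.map g g′
  Σ⁰₀-use (imp {φ} {ψ} d d′) σ ν with k , u ← Σ⁰₀-use d σ ν | k′ , u′ ← Σ⁰₀-use d′ σ ν =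
    k ⊔ k′ , λ σ′ ν′ σ≈ e →
      let f , g = Use-mono φ (m≤m⊔n k k′) u σ′ ν′ σ≈ e
          f′ , g′ = Use-mono ψ (m≤n⊔m k k′) u′ σ′ ν′ σ≈ e
      in (λ h a → f′ (h (g a))) , (λ h a → g′ (h (f a)))
  Σ⁰₀-use (ball t {φ} d) σ ν
    with k , u ← boundedUse (λ {a} → Use-mono {σ = σ} {a Env.∷ ν} φ)
                   (⟦ t ⟧ ν) (λ a _ → Σ⁰₀-use d σ (a Env.∷ ν)) =
    k , λ σ′ ν′ σ≈ e →
      (λ h a a<t → let a<t′ = subst (a <_) (⟦⟧-wk t e a) a<t
                   in proj₁ (u a a<t′ σ′ (a Env.∷ ν′) σ≈ (∷-cong a e))
                        (h a (subst (a <_) (sym (⟦⟧-sub t _ (a Env.∷ ν))) a<t′))) ,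
      (λ h a a<t → let a<t′ = subst (a <_) (⟦⟧-sub t _ (a Env.∷ ν)) a<t
                   in proj₂ (u a a<t′ σ′ (a Env.∷ ν′) σ≈ (∷-cong a e))
                        (h a (subst (a <_) (sym (⟦⟧-wk t e a)) a<t′)))
  Σ⁰₀-use (bex t {φ} d) σ ν
    with k , u ← boundedUse (λ {a} → Use-mono {σ = σ} {a Env.∷ ν} φ)
                   (⟦ t ⟧ ν) (λ a _ → Σ⁰₀-use d σ (a Env.∷ ν)) =
    k , λ σ′ ν′ σ≈ e →
      (λ (a , a<t , h) → let a<t′ = subst (a <_) (⟦⟧-sub t _ (a Env.∷ ν)) a<t
                   in a , subst (a <_) (sym (⟦⟧-wk t e a)) a<t′ ,
                      proj₁ (u a a<t′ σ′ (a Env.∷ ν′) σ≈ (∷-cong a e)) h) ,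
      (λ (a , a<t , h) → let a<t′ = subst (a <_) (⟦⟧-wk t e a) a<t
                   in a , subst (a <_) (sym (⟦⟧-sub t _ (a Env.∷ ν))) a<t′ ,
                      proj₂ (u a a<t′ σ′ (a Env.∷ ν′) σ≈ (∷-cong a e)) h)

module Reductions (em : ExcludedMiddle 0ℓ) where
  open Semantics em

  Reduces-unique : ∀ {p Z X Y} → Reduces p Z X → Reduces p Z Y → ∀ m → X m ≡ Y m
  Reduces-unique {X = X} {Y} (_ , total) (sound , _) m =
    χ-injective X Y m (sound m (χ X m) (Int-elim (total m)))

  Reduces-char : ∀ X → Reduces char (χ X ∷ []) X
  Reduces-char X = (λ _ _ e → e) , λ m → suc m , λ { (f ∷ []) (e ∷ []) → e m ≤-refl }

  Reduces-graph : ∀ f Z → Reduces graph (f ∷ Z) (graphSet f)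
  Reduces-graph f Z = (λ _ _ e → e) , λ m → suc m , λ { (g ∷ Z′) (e ∷ _) →
    cong (λ b → if b then 1 else 0) (graphSet-≈ e m ≤-refl) }

  Reduces-natural : ∀ Z → Reduces natural Z naturalOrder
  Reduces-natural Z = (λ _ _ e → e) , λ m → 0 , λ _ _ → refl

  Reduces-lift : ∀ {p Z X} f → Reduces p Z X → Reduces (lift p) (f ∷ Z) X
  Reduces-lift f (sound , total) = sound ,
    λ m → let k , h = total m in k , λ { (g ∷ Z′) (_ ∷ e) → h Z′ e }

  Reduces-join : ∀ {p q Z X Y} → Reduces p Z X → Reduces q Z Y →
                 Reduces (join p q) Z (X ⊕ Y)
  Reduces-join {p} {q} {Z} {X} {Y} (sound , total) (sound′ , total′) = sound″ , total″
    where
    sound″ : Compatible (⟦ join p q ⟧ᴰ Z) (X ⊕ Y)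
    sound″ m b h with m % 2 ≡ᵇ 0
    ... | true = sound (m / 2) b h
    ... | false = sound′ (m / 2) b h
    total″ : ∀ m → Int (λ Z′ → ⟦ join p q ⟧ᴰ Z′ m (χ (X ⊕ Y) m)) Z
    total″ m with m % 2 ≡ᵇ 0
    ... | true = total (m / 2)
    ... | false = total′ (m / 2)

  -- The values of `Y` below `u` are finitely many, so they are all output on a common
  -- neighbourhood. This turns use bounds into openness.
  compatible-≈ : ∀ p {Z Y} → Reduces p Z Y → ∀ u →
    Int (λ Z′ → ∀ X → Compatible (⟦ p ⟧ᴰ Z′) X → Y ≈[ u ] X) Z
  compatible-≈ p {Z} {Y} (_ , total) u
    with k , h ← boundedUse {λ m k → ∀ Z′ → Z ∼[ k ] Z′ → ⟦ p ⟧ᴰ Z′ m (χ Y m)}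
                   (λ k≤k′ h Z′ e → h Z′ (∼-weaken k≤k′ e)) u (λ m _ → total m) =
    k , λ Z′ e X compat m m<u → χ-injective Y X m (compat m (χ Y m) (h m m<u Z′ e))

  Reduces-code : ∀ {p Z X Y} e → (∀ n → e [ Y ] (n ∷ []) ⇓ χ X n) →
                 Reduces p Z Y → Reduces (code e p) Z X
  Reduces-code {p} {Y = Y} e X≤Y red =
    (λ m b h → ⇓-functional (h Y (proj₁ red)) (X≤Y m)) ,
    λ m → let u , use = ⇓-use (X≤Y m)
          in Int-map (λ approx X′ compat → use X′ (approx X′ compat)) (compatible-≈ p red u)

  -- Membership rests on one witness of `θ` and non-membership on one counterexample to `ψ`. Either
  -- is a Σ⁰₀ fact and reads only a finite part of `Y`.
  Reduces-delta : ∀ {m n p Z Y X} {θ ψ : Form m (suc (suc n))} → Σ⁰₀ θ → Σ⁰₀ ψ →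
    (I : Subset → Set) (σ : Vector Subset m) (ν : Vector ℕ n) →
    Reduces p Z Y → (∀ i k → columns Y i k ≡ σ i k) →
    (∀ a → (T (X a) → Sat I σ (a Env.∷ ν) (∃ⁿ θ)) ×
           (¬ T (X a) → ¬ Sat I σ (a Env.∷ ν) (∀ⁿ ψ))) →
    (∀ a → Sat I σ (a Env.∷ ν) (∃ⁿ θ) → Sat I σ (a Env.∷ ν) (∀ⁿ ψ)) →
    Reduces (delta (∃ⁿ θ) (∀ⁿ ψ) (Vec.tabulate ν) p) Z X
  Reduces-delta {m} {n} {p} {Z} {Y} {X} {θ} {ψ} dθ dψ I σ ν red Y≈σ spec impl =
    sound , total
    where
    ν′ = Vec.lookup (Vec.tabulate ν)
    env : ∀ w a i → (w Env.∷ a Env.∷ ν) i ≡ (w Env.∷ a Env.∷ ν′) i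
    env w a zero = refl
    env w a (suc zero) = refl
    env w a (suc (suc i)) = sym (lookup∘tabulate ν i)

    transfer : ∀ {φ : Form m (suc (suc n))} → Σ⁰₀ φ → ∀ w a → ∃[ k ] ∀ X′ → Y ≈[ k ] X′ →
      (Sat I σ (w Env.∷ a Env.∷ ν) φ →
       Sat (λ _ → ⊥) (columns X′) (w Env.∷ a Env.∷ ν′) φ) ×
      (Sat (λ _ → ⊥) (columns X′) (w Env.∷ a Env.∷ ν′) φ →
       Sat I σ (w Env.∷ a Env.∷ ν) φ)
    transfer d w a =
      let k , use = Σ⁰₀-use I (λ _ → ⊥) d σ (w Env.∷ a Env.∷ ν)
          K , near = columns-≈ {m} k
      in K , λ X′ Y≈X′ → use (columns X′) (w Env.∷ a Env.∷ ν′)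
           (λ i j j<k → trans (sym (Y≈σ i j)) (near Y≈X′ i j j<k)) (env w a)

    sound : Compatible (⟦ delta (∃ⁿ θ) (∀ⁿ ψ) (Vec.tabulate ν) p ⟧ᴰ Z) X
    sound a b h with h Y (proj₁ red)
    ... | inj₁ (refl , w , t) = sym (T⇒χ≡1 X a (dne em λ ¬x → proj₂ (spec a) ¬x
            (impl a (w , proj₂ (proj₂ (transfer dθ w a) Y ≈-refl) t))))
    ... | inj₂ (refl , ¬ψ) = sym (¬T⇒χ≡0 X a λ x → ¬ψ λ w →
            proj₁ (proj₂ (transfer dψ w a) Y ≈-refl) (impl a (proj₁ (spec a) x) w))

    total : ∀ a → Int (λ Z′ → ⟦ delta (∃ⁿ θ) (∀ⁿ ψ) (Vec.tabulate ν) p ⟧ᴰ Z′ a (χ X a)) Z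
    total a with em {T (X a)}
    ... | yes x =
      let w , t = proj₁ (spec a) x
          u , use = transfer dθ w a
      in Int-map (λ approx X′ compat → inj₁
           (T⇒χ≡1 X a x , w , proj₁ (use X′ (approx X′ compat)) t)) (compatible-≈ p red u)
    ... | no ¬x =
      let w , ¬t = ¬∀⇒∃¬ em (proj₂ (spec a) ¬x)
          u , use = transfer dψ w a
      in Int-map (λ approx X′ compat → inj₂
           (¬T⇒χ≡0 X a ¬x , λ h → ¬t (proj₂ (use X′ (approx X′ compat)) (h w))))
           (compatible-≈ p red u)

-- The ideal

module Ideal (em : ExcludedMiddle 0ℓ) where
  open Semantics em
  open Reductions em
  open GenericPoset em using (_≼ᵇ_; A; relOracle; ≼-natPoset; ≼-stable; ≼-hyperimmune)

  private
    B = λ x → ¬ A x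
    DH = DependentlyHyperimmune A B

  Monotone : (ℕ → ℕ → Set) → (ℕ → ℕ) → Set
  Monotone _≺_ f = (∀ k l → k < l → f k ≺ f l) ⊎ (∀ k l → k < l → f l ≺ f k)

  -- Solving one decoded order solves every `L` decoded by `d`, since any two such sets have the
  -- same elements.
  next : ∀ Z → DH Z → ∀ d → ∃[ f ] (DH (f ∷ Z) ×
         ∀ L → Reduces d Z L → IsStrictLinear (Rel L) → Monotone (Rel L) f)
  next Z dh d with em {∃[ L ] (Reduces d Z L × IsStrictLinear (Rel L))}
  ... | yes (L , red , lin) =
    let f , dh′ , mono = solve d L red lin
    in f , dh′ , λ L′ red′ _ → Sum.map
         (λ h k l k<l → subst T (Reduces-unique {d} red red′ _) (h k l k<l))
         (λ h k l k<l → subst T (Reduces-unique {d} red red′ _) (h k l k<l)) mono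
    where
    solve : ∀ d L → Reduces d Z L → IsStrictLinear (Rel L) →
            ∃[ f ] (DH (f ∷ Z) × Monotone (Rel L) f)
    solve d L red lin = Sequence.solve em A B dh d (Rel L) lin
      (λ x y x≺y → subst (λ b → Int (λ Z′ → ⟦ d ⟧ᴰ Z′ (pair x y) b) Z)
                     (T⇒χ≡1 L (pair x y) x≺y) (proj₂ red (pair x y)))
      (λ x y h → χ≡1⇒T L (pair x y) (proj₁ red (pair x y) 1 h))
  -- If `d` decodes no linear order, the natural order is solved instead, only to prolong the
  -- oracle.
  ... | no ¬L =
    let f , dh′ , _ = Sequence.solve em A B dh natural _<_
          ((λ x → <-irrefl refl) , (λ x y z → <-trans) , <-total)
          (λ x y x<y → subst (λ b → Int (λ Z′ → ⟦ natural ⟧ᴰ Z′ (pair x y) b) Z)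
             (T⇒χ≡1 naturalOrder (pair x y) (relSet⁺ x<y))
             (proj₂ (Reduces-natural Z) (pair x y)))
          (λ x y h → relSet⁻ (χ≡1⇒T naturalOrder (pair x y) h))
    in f , dh′ , λ L red lin → ⊥-elim (¬L (L , red , lin))
    where
    <-total : ∀ x y → x < y ⊎ x ≡ y ⊎ y < x
    <-total x y with <-cmp x y
    ... | tri< x<y _ _ = inj₁ x<y
    ... | tri≈ _ x≡y _ = inj₂ (inj₁ x≡y)
    ... | tri> _ _ y<x = inj₂ (inj₂ y<x)

  liftBy : ℕ → Decoder → Decoder
  liftBy zero p = p
  liftBy (suc d) p = lift (liftBy d p)

  -- Stage n treats decoder number i relative to stage s, where n codes (s , i).
  requirement : ℕ → Decoder
  requirement n = liftBy (n ∸ proj₁ (unpair n)) (decoderAt (proj₂ (unpair n)))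

  stage : ℕ → ∃[ Z ] DH Z
  stage zero = relOracle _≼ᵇ_ , ≼-hyperimmune
  stage (suc n) = let Z , dh = stage n
                      f , dh′ , _ = next Z dh (requirement n)
                  in f ∷ Z , dh′

  oracleAt : ℕ → Oracle
  oracleAt n = proj₁ (stage n)

  sequence : ℕ → ℕ → ℕ
  sequence n = proj₁ (next (oracleAt n) (proj₂ (stage n)) (requirement n))

  sequence-monotone : ∀ n L → Reduces (requirement n) (oracleAt n) L →
                      IsStrictLinear (Rel L) → Monotone (Rel L) (sequence n)
  sequence-monotone n = proj₂ (proj₂ (next (oracleAt n) (proj₂ (stage n)) (requirement n)))

  𝓘 : Subset → Set
  𝓘 X = ∃[ n ] ∃[ p ] Reduces p (oracleAt n) X

  Reduces-liftBy : ∀ d {p n X} → Reduces p (oracleAt n) X →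
                   Reduces (liftBy d p) (oracleAt (d + n)) X
  Reduces-liftBy zero red = red
  Reduces-liftBy (suc d) {p} {n} {X} red =
    Reduces-lift {liftBy d p} {oracleAt (d + n)} {X} (sequence (d + n))
      (Reduces-liftBy d {p} {n} {X} red)

  𝓘-ideal : TuringIdeal 𝓘
  𝓘-ideal = record
    { nonempty = naturalOrder , 0 , natural , Reduces-natural (oracleAt 0)
    ; downward = λ { {X} {Y} (e , X≤Y) (n , p , red) →
        n , code e p , Reduces-code {p} {oracleAt n} {X} {Y} e X≤Y red }
    ; join = λ { {X} {Y} (n , p , red) (n′ , q , red′) →
        n′ + n , join (liftBy n′ p) (liftBy n q) ,
        Reduces-join {liftBy n′ p} {liftBy n q} {oracleAt (n′ + n)} {X} {Y}
          (Reduces-liftBy n′ {p} {n} {X} red)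
          (subst (λ k → Reduces (liftBy n q) (oracleAt k) Y) (+-comm n n′)
            (Reduces-liftBy n {q} {n′} {Y} red′)) }
    }

  -- An order decoded at stage `s` by decoder number `i` is lifted to the stage `n` that codes (s ,
  -- i). The sequence added there solves it, and stage n + 1 decodes its graph.
  𝓘-ADS : 𝓘 ⊨ ADS
  𝓘-ADS L (s , p , red) lin
    with i , refl ← decoderAt-onto p
    with n , e ← unpair-onto s i =
    graphSet f , (suc n , graph , Reduces-graph f (oracleAt n)) ,
    ((λ x → f x , relSet⁺ {x = x} refl) ,
     (λ x y z xy xz → trans (sym (relSet⁻ {x = x} {y} xy)) (relSet⁻ {x = x} {z} xz))) ,
    Sum.map
      (λ h k l a b k<l ka lb → subst₂ (Rel L) (relSet⁻ ka) (relSet⁻ lb) (h k l k<l))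
      (λ h k l a b k<l ka lb → subst₂ (Rel L) (relSet⁻ lb) (relSet⁻ ka) (h k l k<l))
      (sequence-monotone n L red′ lin)
    where
    f = sequence n
    s≤n : s ≤ n
    s≤n = ≤-trans (≤-trans (m≤m+n s i) (≤-reflexive (cong (λ (a , b) → a + b) (sym e))))
                  (unpair-≤ n)
    red′ : Reduces (requirement n) (oracleAt n) L
    red′ = subst₂ (λ q k → Reduces q (oracleAt k) L)
      (cong (λ (a , b) → liftBy (n ∸ a) (decoderAt b)) (sym e)) (m∸n+n≡m s≤n)
      (Reduces-liftBy (n ∸ s) {decoderAt i} {s} {L} red)

  ≼ : Subset
  ≼ = relSet (λ x y → T (x ≼ᵇ y))

  module _ {S : Subset} (infinite : ∀ x → ∃[ y ] (y > x × T (S y)))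
           {n p} (red : Reduces p (oracleAt n) S) where

    private
      hits : ∀ h → T (S h) → Int (λ Z → ⟦ p ⟧ᴰ Z h 1) (oracleAt n)
      hits h Sh = subst (λ b → Int (λ Z → ⟦ p ⟧ᴰ Z h b) (oracleAt n))
                    (T⇒χ≡1 S h Sh) (proj₂ red h)

    -- Singletons from `S` beyond any bound, paired with the empty list, make `hitU p` essential.
    meets-A : ∃[ h ] (T (S h) × A h)
    meets-A
      with R , _ , aR , _ , holds ← proj₂ (stage n) (hitU p) (λ x →
             let h , x<h , Sh = infinite x
             in h ∷ [] , x<h ∷ [] , λ y → [] , [] ,
                Int-map (λ r → h , here refl , r) (hits h Sh))
      with h , h∈ , r ← Int-elim holds = h , χ≡1⇒T S h (proj₁ red h 1 r) , All.lookup aR h∈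

    meets-B : ∃[ h ] (T (S h) × ¬ A h)
    meets-B
      with _ , R , _ , bR , holds ← proj₂ (stage n) (hitV p) (λ x →
             [] , [] , λ y → let h , y<h , Sh = infinite y
             in h ∷ [] , y<h ∷ [] ,
                Int-map (λ r → h , here refl , r) (hits h Sh))
      with h , h∈ , r ← Int-elim holds = h , χ≡1⇒T S h (proj₁ red h 1 r) , All.lookup bR h∈

  -- By `meets-B` a chain would contain an element outside A, which is incomparable to all large
  -- elements; by `meets-A` an antichain would contain an element of A, which is below all large
  -- ones.
  𝓘-¬SCAC : ¬ (𝓘 ⊨ SCAC)
  𝓘-¬SCAC scac =
    let S , (n , p , red) , infinite , homogeneous =
          scac ≼ (0 , char , Reduces-char ≼) (poset , inj₁ stable)
    in Sum.[ no-chain infinite (meets-B infinite {n} {p} red) ,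
             no-antichain infinite (meets-A infinite {n} {p} red) ] homogeneous
    where
    open NatPoset ≼-natPoset

    poset : (∀ x → Rel ≼ x x) × (∀ x y → Rel ≼ x y → Rel ≼ y x → x ≡ y)
          × (∀ x y z → Rel ≼ x y → Rel ≼ y z → Rel ≼ x z)
    poset = (λ x → relSet⁺ (reflexive x)) ,
      (λ x y xy yx → ≤-antisym (⇒≤ (relSet⁻ xy)) (⇒≤ (relSet⁻ yx))) ,
      (λ x y z xy yz → relSet⁺ {x = x} {z}
        (transitive (relSet⁻ {x = x} {y} xy) (relSet⁻ {x = y} {z} yz)))

    not-below : ∀ {a b y} → a ≤ b → b < y → ¬ Rel ≼ y a
    not-below a≤b b<y ya = <-irrefl refl (<-≤-trans b<y (≤-trans (⇒≤ (relSet⁻ ya)) a≤b))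

    stable : ∀ a → (∃[ x ] (∀ y → y > x → Rel ≼ a y))
                 ⊎ (∃[ x ] (∀ y → y > x → ¬ Rel ≼ a y × ¬ Rel ≼ y a))
    stable a with b , a≤b , below , apart ← ≼-stable a with em {A a}
    ... | yes Aa = inj₁ (b , λ y b<y → relSet⁺ (below Aa y b<y))
    ... | no ¬Aa = inj₂ (b , λ y b<y →
      (λ ay → apart ¬Aa y b<y (relSet⁻ ay)) , not-below a≤b b<y)

    no-chain : ∀ {S : Subset} → (∀ x → ∃[ y ] (y > x × T (S y))) →
      ∃[ h ] (T (S h) × ¬ A h) →
      ¬ (∀ x y → T (S x) → T (S y) → Rel ≼ x y ⊎ Rel ≼ y x)
    no-chain infinite (h , Sh , ¬Ah) chain
      with b , h≤b , _ , apart ← ≼-stable h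
      with y , b<y , Sy ← infinite b
      with chain h y Sh Sy
    ... | inj₁ hy = apart ¬Ah y b<y (relSet⁻ hy)
    ... | inj₂ yh = not-below h≤b b<y yh

    no-antichain : ∀ {S : Subset} → (∀ x → ∃[ y ] (y > x × T (S y))) →
      ∃[ h ] (T (S h) × A h) →
      ¬ (∀ x y → T (S x) → T (S y) → x ≢ y → ¬ Rel ≼ x y × ¬ Rel ≼ y x)
    no-antichain infinite (h , Sh , Ah) antichain
      with b , h≤b , below , _ ← ≼-stable h
      with y , b<y , Sy ← infinite b =
      proj₁ (antichain h y Sh Sy λ { refl → <-irrefl refl (<-≤-trans b<y h≤b) })
        (relSet⁺ (below Ah y b<y))

-- Soundness

module Soundness (em : ExcludedMiddle 0ℓ) (I : Subset → Set) where

  -- Environments are functions and are compared pointwise, as function extensionality is not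
  -- assumed.
  _≐_ : {A : Set} {k : ℕ} → Vector A k → Vector A k → Set
  σ ≐ σ′ = ∀ i → σ i ≡ σ′ i

  liftⁿ-env : ∀ {n n′} (τ : Fin n → Term n′) (ν : Vector ℕ n′) {ν′} a →
              ν′ ≐ (λ i → ⟦ τ i ⟧ ν) →
              (a Env.∷ ν′) ≐ (λ i → ⟦ liftⁿ τ i ⟧ (a Env.∷ ν))
  liftⁿ-env τ ν a e zero = refl
  liftⁿ-env τ ν a e (suc i) = trans (e i) (sym (⟦⟧-sub (τ i) (var ∘ suc) (a Env.∷ ν)))

  liftˢ-env : ∀ {m m′} (ρ : Fin m → Fin m′) {σ : Vector Subset m′} {σ′} X →
              σ′ ≐ (σ ∘ ρ) → (X Env.∷ σ′) ≐ ((X Env.∷ σ) ∘ Fin.lift 1 ρ)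
  liftˢ-env ρ X e zero = refl
  liftˢ-env ρ X e (suc i) = e i

  infix 3 _⟺_
  _⟺_ : Set → Set → Set
  P ⟺ Q = (P → Q) × (Q → P)

  -- The substitution lemma; both directions are proved together because implication reverses them.
  Sat-sub : ∀ {m m′ n n′} (φ : Form m n) (ρ : Fin m → Fin m′) (τ : Fin n → Term n′)
            {σ ν σ′ ν′} → σ′ ≐ (σ ∘ ρ) → ν′ ≐ (λ i → ⟦ τ i ⟧ ν) →
            Sat I σ ν (sub ρ τ φ) ⟺ Sat I σ′ ν′ φ

  term-sub : ∀ {n n′} (t : Term n) (τ : Fin n → Term n′) {ν ν′} →
             ν′ ≐ (λ i → ⟦ τ i ⟧ ν) → ⟦ subᵗ τ t ⟧ ν ≡ ⟦ t ⟧ ν′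
  term-sub t τ {ν} e = trans (⟦⟧-sub t τ ν) (sym (⟦⟧-cong t e))

  Sat-sub (s `≡ t) ρ τ eσ eν =
    subst₂ _≡_ (term-sub s τ eν) (term-sub t τ eν) ,
    subst₂ _≡_ (sym (term-sub s τ eν)) (sym (term-sub t τ eν))
  Sat-sub (s `< t) ρ τ eσ eν =
    subst₂ _<_ (term-sub s τ eν) (term-sub t τ eν) ,
    subst₂ _<_ (sym (term-sub s τ eν)) (sym (term-sub t τ eν))
  Sat-sub (t `∈ X) ρ τ eσ eν =
    subst T (cong₂ (λ f → f) (sym (eσ X)) (term-sub t τ eν)) ,
    subst T (sym (cong₂ (λ f → f) (sym (eσ X)) (term-sub t τ eν)))
  Sat-sub `⊥ ρ τ eσ eν = (λ x → x) , (λ x → x)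
  Sat-sub (φ `∧ ψ) ρ τ eσ eν =
    let f , g = Sat-sub φ ρ τ eσ eν ; f′ , g′ = Sat-sub ψ ρ τ eσ eν
    in (λ (a , b) → f a , f′ b) , (λ (a , b) → g a , g′ b)
  Sat-sub (φ `∨ ψ) ρ τ eσ eν =
    let f , g = Sat-sub φ ρ τ eσ eν ; f′ , g′ = Sat-sub ψ ρ τ eσ eν
    in Sum.map f f′ , Sum.map g g′
  Sat-sub (φ `⇒ ψ) ρ τ eσ eν =
    let f , g = Sat-sub φ ρ τ eσ eν ; f′ , g′ = Sat-sub ψ ρ τ eσ eν
    in (λ h a → f′ (h (g a))) , (λ h a → g′ (h (f a)))
  Sat-sub (∀ⁿ φ) ρ τ {ν = ν} eσ eν =
    (λ h a → proj₁ (Sat-sub φ ρ (liftⁿ τ) eσ (liftⁿ-env τ ν a eν)) (h a)) ,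
    (λ h a → proj₂ (Sat-sub φ ρ (liftⁿ τ) eσ (liftⁿ-env τ ν a eν)) (h a))
  Sat-sub (∃ⁿ φ) ρ τ {ν = ν} eσ eν =
    (λ (a , h) → a , proj₁ (Sat-sub φ ρ (liftⁿ τ) eσ (liftⁿ-env τ ν a eν)) h) ,
    (λ (a , h) → a , proj₂ (Sat-sub φ ρ (liftⁿ τ) eσ (liftⁿ-env τ ν a eν)) h)
  Sat-sub (∀ˢ φ) ρ τ eσ eν =
    (λ h X IX → proj₁ (Sat-sub φ (Fin.lift 1 ρ) τ (liftˢ-env ρ X eσ) eν) (h X IX)) ,
    (λ h X IX → proj₂ (Sat-sub φ (Fin.lift 1 ρ) τ (liftˢ-env ρ X eσ) eν) (h X IX))
  Sat-sub (∃ˢ φ) ρ τ eσ eν =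
    (λ (X , IX , h) → X , IX ,
      proj₁ (Sat-sub φ (Fin.lift 1 ρ) τ (liftˢ-env ρ X eσ) eν) h) ,
    (λ (X , IX , h) → X , IX ,
      proj₂ (Sat-sub φ (Fin.lift 1 ρ) τ (liftˢ-env ρ X eσ) eν) h)

  module _ {m n} {σ : Vector Subset m} {ν : Vector ℕ n} where

    Sat-wkⁿ : ∀ φ a → Sat I σ (a Env.∷ ν) (wkⁿ φ) ⟺ Sat I σ ν φ
    Sat-wkⁿ φ a = Sat-sub φ _ _ (λ _ → refl) (λ _ → refl)

    Sat-wkˢ : ∀ φ X → Sat I (X Env.∷ σ) ν (wkˢ φ) ⟺ Sat I σ ν φ
    Sat-wkˢ φ X = Sat-sub φ _ _ (λ _ → refl) (λ _ → refl)

    Sat-[]ⁿ : ∀ φ t → Sat I σ ν (φ [ t ]ⁿ) ⟺ Sat I σ (⟦ t ⟧ ν Env.∷ ν) φ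
    Sat-[]ⁿ φ t = Sat-sub φ _ _ (λ _ → refl) λ { zero → refl ; (suc i) → refl }

    Sat-[]ˢ : ∀ φ X → Sat I σ ν (φ [ X ]ˢ) ⟺ Sat I (σ X Env.∷ σ) ν φ
    Sat-[]ˢ φ X = Sat-sub φ _ _ (λ { zero → refl ; (suc i) → refl }) (λ _ → refl)

  -- Set parameters range over `I`, as `∀ˢE` and `∃ˢI` instantiate set quantifiers by them. Excluded
  -- middle enters through `raa`.
  sound : ∀ {m n} {Γ : List (Form m n)} {φ} → Γ ⊢ φ →
          ∀ σ → (∀ i → I (σ i)) → ∀ ν → All (Sat I σ ν) Γ → Sat I σ ν φ
  sound (hyp φ∈) σ Iσ ν γ = All.lookup γ φ∈
  sound (raa d) σ Iσ ν γ = dne em λ ¬φ → sound d σ Iσ ν (¬φ ∷ γ)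
  sound (∧I d e) σ Iσ ν γ = sound d σ Iσ ν γ , sound e σ Iσ ν γ
  sound (∧E₁ d) σ Iσ ν γ = proj₁ (sound d σ Iσ ν γ)
  sound (∧E₂ d) σ Iσ ν γ = proj₂ (sound d σ Iσ ν γ)
  sound (∨I₁ d) σ Iσ ν γ = inj₁ (sound d σ Iσ ν γ)
  sound (∨I₂ d) σ Iσ ν γ = inj₂ (sound d σ Iσ ν γ)
  sound (∨E d e f) σ Iσ ν γ with sound d σ Iσ ν γ
  ... | inj₁ h = sound e σ Iσ ν (h ∷ γ)
  ... | inj₂ h = sound f σ Iσ ν (h ∷ γ)
  sound (⇒I d) σ Iσ ν γ = λ h → sound d σ Iσ ν (h ∷ γ)
  sound (⇒E d e) σ Iσ ν γ = sound d σ Iσ ν γ (sound e σ Iσ ν γ)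
  sound (∀ⁿI d) σ Iσ ν γ = λ a → sound d σ Iσ (a Env.∷ ν)
    (All.map⁺ (All.map (λ {φ} → proj₂ (Sat-wkⁿ φ a)) γ))
  sound (∀ⁿE {φ} t d) σ Iσ ν γ = proj₂ (Sat-[]ⁿ φ t) (sound d σ Iσ ν γ (⟦ t ⟧ ν))
  sound (∃ⁿI {φ} t d) σ Iσ ν γ = ⟦ t ⟧ ν , proj₁ (Sat-[]ⁿ φ t) (sound d σ Iσ ν γ)
  sound (∃ⁿE {ψ = ψ} d e) σ Iσ ν γ with a , h ← sound d σ Iσ ν γ =
    proj₁ (Sat-wkⁿ ψ a) (sound e σ Iσ (a Env.∷ ν)
      (h ∷ All.map⁺ (All.map (λ {φ} → proj₂ (Sat-wkⁿ φ a)) γ)))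
  sound (∀ˢI d) σ Iσ ν γ = λ X IX → sound d (X Env.∷ σ) (∷-ideal IX Iσ) ν
    (All.map⁺ (All.map (λ {φ} → proj₂ (Sat-wkˢ φ X)) γ))
    where
    ∷-ideal : ∀ {m X} {σ : Vector Subset m} → I X → (∀ i → I (σ i)) →
              ∀ i → I ((X Env.∷ σ) i)
    ∷-ideal IX Iσ zero = IX
    ∷-ideal IX Iσ (suc i) = Iσ i
  sound (∀ˢE {φ} X d) σ Iσ ν γ = proj₂ (Sat-[]ˢ φ X) (sound d σ Iσ ν γ (σ X) (Iσ X))
  sound (∃ˢI {φ} X d) σ Iσ ν γ =
    σ X , Iσ X , proj₁ (Sat-[]ˢ φ X) (sound d σ Iσ ν γ)
  sound (∃ˢE {ψ = ψ} d e) σ Iσ ν γ with X , IX , h ← sound d σ Iσ ν γ =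
    proj₁ (Sat-wkˢ ψ X) (sound e (X Env.∷ σ) (λ { zero → IX ; (suc i) → Iσ i }) ν
      (h ∷ All.map⁺ (All.map (λ {φ} → proj₂ (Sat-wkˢ φ X)) γ)))
  sound ≡I σ Iσ ν γ = refl
  sound (≡E φ {s} {t} d e) σ Iσ ν γ = proj₂ (Sat-[]ⁿ φ t)
    (subst (λ a → Sat I σ (a Env.∷ ν) φ) (sound d σ Iσ ν γ)
      (proj₁ (Sat-[]ⁿ φ s) (sound e σ Iσ ν γ)))

  ⊨closeˢ : ∀ {m} (φ : Form m 0) → (∀ σ → (∀ i → I (σ i)) → ∀ ν → Sat I σ ν φ) →
            I ⊨ closeˢ φ
  ⊨closeˢ {zero} φ h = h _ (λ ()) _
  ⊨closeˢ {suc m} φ h = ⊨closeˢ (∀ˢ φ) λ σ Iσ ν X IX →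
    h (X Env.∷ σ) (λ { zero → IX ; (suc i) → Iσ i }) ν

  ⊨close : ∀ {m n} (φ : Form m n) → (∀ σ → (∀ i → I (σ i)) → ∀ ν → Sat I σ ν φ) →
           I ⊨ close φ
  ⊨close {n = zero} φ h = ⊨closeˢ φ h
  ⊨close {n = suc n} φ h = ⊨close (∀ⁿ φ) λ σ Iσ ν a → h σ Iσ (a Env.∷ ν)

  +1≡suc : ∀ {a b} → a + 1 ≡ b → suc a ≡ b
  +1≡suc {a} e = trans (+-comm 1 a) e

  inductionAxiom : ∀ {m n} → Form m (suc n) → Form m n
  inductionAxiom φ =
    φ [ `0 ]ⁿ `∧ (∀ⁿ φ `⇒ sub (λ X → X) ((v 0 `+ `1) Env.∷ (var ∘ suc)) φ) `⇒ (∀ⁿ φ)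

  -- Numbers are standard, so induction on them gives the axiom for all formulas, whatever `I` is.
  ⊨induction : ∀ {m n} (φ : Form m (suc n)) → I ⊨ close (inductionAxiom φ)
  ⊨induction φ = ⊨close (inductionAxiom φ) λ σ Iσ ν (base , step) a → induct σ ν base step a
    where
    induct : ∀ σ ν → Sat I σ ν (φ [ `0 ]ⁿ) →
      Sat I σ ν (∀ⁿ φ `⇒ sub (λ X → X) ((v 0 `+ `1) Env.∷ (var ∘ suc)) φ) →
      ∀ a → Sat I σ (a Env.∷ ν) φ
    induct σ ν base step zero = proj₁ (Sat-[]ⁿ φ `0) base
    induct σ ν base step (suc a) =
      proj₁ (Sat-sub φ _ _ (λ _ → refl) λ { zero → +-comm 1 a ; (suc i) → refl })
        (step a (induct σ ν base step a))

  Comprehension : Set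
  Comprehension = ∀ {m n} {φ ψ : Form m (suc n)} → Σ⁰₁ φ → Π⁰₁ ψ →
    ∀ σ → (∀ i → I (σ i)) → ∀ ν → (∀ a → Sat I σ (a Env.∷ ν) (φ `⇔ ψ)) →
    ∃[ X ] (I X × ∀ a → T (X a) ⟺ Sat I σ (a Env.∷ ν) φ)

  ⊨RCA₀ : Comprehension → ∀ {φ} → RCA₀ φ → I ⊨ φ
  ⊨RCA₀ ca suc≢0 = λ a e → contradiction (+1≡suc e) λ ()
  ⊨RCA₀ ca suc-inj = λ a b e → +-cancelʳ-≡ 1 a b e
  ⊨RCA₀ ca +-zero = +-identityʳ
  ⊨RCA₀ ca RCA₀.+-suc = λ a b → sym (+-assoc a b 1)
  ⊨RCA₀ ca *-zero = *-zeroʳ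
  ⊨RCA₀ ca RCA₀.*-suc = λ a b → trans (*-distribˡ-+ a b 1) (cong (a * b +_) (*-identityʳ a))
  ⊨RCA₀ ca ≮0 = λ a ()
  ⊨RCA₀ ca <-suc = λ a b →
    (λ a<b+1 → m≤n⇒m<n∨m≡n (s≤s⁻¹ (subst (a <_) (+-comm b 1) a<b+1))) ,
    λ { (inj₁ a<b) → <-≤-trans a<b (m≤m+n b 1)
      ; (inj₂ refl) → subst (a <_) (+-comm 1 b) ≤-refl }
  ⊨RCA₀ ca (Σ⁰₁-ind {φ = φ} _) = ⊨induction φ
  ⊨RCA₀ ca (Δ⁰₁-CA {φ = φ} {ψ} s p) =
    ⊨close ((∀ⁿ φ `⇔ ψ) `⇒ (∃ˢ ∀ⁿ v 0 `∈ zero `⇔ wkˢ φ)) λ σ Iσ ν h →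
    let X , IX , spec = ca s p σ Iσ ν h
    in X , IX , λ a →
      (λ x → proj₂ (Sat-wkˢ φ X) (proj₁ (spec a) x)) ,
      (λ t → proj₂ (spec a) (proj₁ (Sat-wkˢ φ X) t))

-- Comprehension in the ideal and the failure of the implication

module _ (em : ExcludedMiddle 0ℓ) where
  open Semantics em
  open Reductions em
  open Ideal em
  open Soundness em 𝓘

  -- Gathers the set parameters of a formula as the columns of one member of the ideal, since
  -- `delta` decodes from a single set.
  joinAll : ∀ {m} (σ : Vector Subset m) → (∀ i → 𝓘 (σ i)) →
            ∃[ Y ] (𝓘 Y × ∀ i k → columns Y i k ≡ σ i k)
  joinAll {zero} σ Iσ = let X , IX = TuringIdeal.nonempty 𝓘-ideal in X , IX , λ ()
  joinAll {suc m} σ Iσ =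
    let Y , IY , h = joinAll (σ ∘ suc) (Iσ ∘ suc)
    in σ zero ⊕ Y , TuringIdeal.join 𝓘-ideal (Iσ zero) IY , λ where
         zero k → ⊕-even (σ zero) Y k
         (suc i) k → trans (⊕-odd (σ zero) Y (columnIndex i k)) (h i k)

  -- The set exists by excluded middle; `delta` then witnesses that it belongs to the ideal.
  𝓘-comprehension : Comprehension
  𝓘-comprehension {φ = φ} (ex {θ} dθ) (all {ψ} dψ) σ Iσ ν φ⇔ψ =
    let Y , (n , p , red) , Y≈σ = joinAll σ Iσ
    in X , (n , delta (∃ⁿ θ) (∀ⁿ ψ) (Vec.tabulate ν) p ,
        Reduces-delta {p = p} {X = X} dθ dψ 𝓘 σ ν red Y≈σ
          (λ a → decide⁻ , λ ¬x ∀ψ → ¬x (decide⁺ (proj₂ (φ⇔ψ a) ∀ψ)))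
          (λ a → proj₁ (φ⇔ψ a))) ,
       λ a → decide⁻ , decide⁺
    where
    X : Subset
    X a = decide (Sat 𝓘 σ (a Env.∷ ν) (∃ⁿ θ))

  RCA₀⊬ADS⇒SCAC : ¬ (RCA₀ ⊩ ADS `⇒ SCAC)
  RCA₀⊬ADS⇒SCAC (Γ , axioms , d) = 𝓘-¬SCAC
    (sound d _ (λ ()) _ (All.map (⊨RCA₀ 𝓘-comprehension) axioms) 𝓘-ADS)

theorem1p7 : ExcludedMiddle 0ℓ →
    (∃[ I ] (TuringIdeal I × (I ⊨ ADS) × ¬ (I ⊨ SCAC)))
    × ¬ (RCA₀ ⊩ ADS `⇒ SCAC)
theorem1p7 em = (𝓘 , 𝓘-ideal , 𝓘-ADS , 𝓘-¬SCAC) , RCA₀⊬ADS⇒SCAC em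
  where open Ideal em
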